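{- Let $G$ be a connected weighted graph of order $n\ge 2$. Then $$K(G)\ \ge\ n-2+\frac{1}{\chi(G)}.$$ If $G$ is unweighted, equality holds if and only if one of the following holds: (i) $\chi(G)=2$ and $G$ is complete bipartite; (ii) $\chi(G)=r\ge 3$, $r$ divides $n$, and $G\cong T_r(n)$, the balanced complete $r$-partite graph on $n$ vertices.
   Context: Graphs are finite, simple, connected, undirected and weighted: $G=(V,E,c)$ with symmetric weights $c(i,j)=c_{ij}=c_{ji}>0$ if $\{i,j\}\in E$ and $c_{ij}=0$ otherwise (no loops), $|V|=n$; $G$ is unweighted if all edge weights equal $1$. $\chi(G)$ is the chromatic number of the underlying graph $(V,E)$. The degree of vertex $i$ is $k_i=\sum_j c_{ij}$, $D=\operatorname{diag}(k_1,\dots,k_n)$, $A=(c_{ij})$ is the adjacency matrix. The normalized adjacency matrix is $M_G=D^{ -1/2}AD^{ -1/2}$, with eigenvalues $1=\lambda_1>\lambda_2\ge\cdots\ge\lambda_n\ge-1$. Kemeny's constant is $K(G)=\sum_i\pi_i m_{ji}-1$ for the random walk with transition matrix $D^{ -1}A$, where $\pi$ is the stationary distribution and $m_{ji}$ the mean first passage time from $j$ to $i$ (with $m_{jj}$ the mean first return time); this does not depend on $j$, and it is known that $K(G)=\sum_{j=2}^{n}\frac{1}{1-\lambda_j}$. For $r\mid n$, $T_r(n)$ is the complete $r$-partite graph with all parts of size $n/r$. -}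

module Defs where

open import Level using (Level; _⊔_; 0ℓ) renaming (suc to lsuc)
open import Algebra.Bundles using (CommutativeRing)
open import Algebra.Apartness.Bundles using (HeytingCommutativeRing; HeytingField)
import Algebra.Apartness.Properties.HeytingCommutativeRing as HCR
import Algebra.Definitions.RawMonoid as RawMonoidDefs
import Algebra.Properties.Ring as RingProps
open import Data.Bool.Base using (if_then_else_)
open import Data.Empty using (⊥-elim)
open import Data.Fin.Base using (Fin; zero; suc; toℕ)
open import Data.Fin.Properties using (nonZeroIndex) renaming (_≟_ to _≟F_)
open import Data.Nat.Base as ℕ using (ℕ; zero; suc; z≤n; s≤s; NonZero)
open import Data.Nat.Divisibility using (_∣_; quotient)
open import Data.Product.Base using (Σ; Σ-syntax; ∃; ∃-syntax; _×_; _,_; proj₁; proj₂)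
open import Data.Sum.Base using (_⊎_; inj₁; inj₂; [_,_]′)
open import Data.Vec.Functional using (Vector)
open import Function.Base using (_∘_)
open import Function.Bundles using (_⇔_; _↔_; Equivalence; Inverse)
open import Relation.Binary.Core using (Rel)
open import Relation.Binary.Construct.Closure.ReflexiveTransitive using (Star; ε; _◅_)
open import Relation.Binary.Definitions using (Symmetric; Irreflexive; Decidable)
open import Relation.Binary.PropositionalEquality.Core as ≡ using (_≡_; _≢_)
open import Relation.Binary.Structures using (IsStrictPartialOrder)
open import Relation.Nullary.Decidable.Core using (does; yes; no; ¬?)
open import Relation.Nullary.Negation.Core using (¬_)

------------------------------------------------------------------------
-- The real numbers

-- The library has no real numbers, so ℝ is given by its axioms: a complete
-- Archimedean ordered field.  The axioms are the constructive ones (an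
-- apartness x # y, and no decidability of the order), so that Cauchy reals
-- satisfy them without excluded middle.  Cotransitivity of _<_ and
-- antisymmetry of _≤_ follow from the corresponding properties of _#_.

record RealField (c ℓ₁ ℓ₂ : Level) : Set (lsuc (c ⊔ ℓ₁ ⊔ ℓ₂)) where
  field
    heytingField : HeytingField c ℓ₁ ℓ₂

  open HeytingField heytingField public hiding (zero)

  commutativeRing : CommutativeRing c ℓ₁
  commutativeRing = HeytingCommutativeRing.commutativeRing heytingCommutativeRing

  open RawMonoidDefs (CommutativeRing.+-rawMonoid commutativeRing) public
    using (sum) renaming (_×_ to _times_)

  fromℕ : ℕ → Carrier
  fromℕ n = n times 1#

  infix 4 _<_ _≤_

  field
    _<_                  : Rel Carrier ℓ₂
    isStrictPartialOrder : IsStrictPartialOrder _≈_ _<_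
    #⇔<⊎>                : ∀ x y → x # y ⇔ (x < y ⊎ y < x)
    +-monoˡ-<            : ∀ z {x y} → x < y → x + z < y + z
    *-pos                : ∀ {x y} → 0# < x → 0# < y → 0# < x * y
    archimedean          : ∀ x → ∃[ n ] x < fromℕ n

  _≤_ : Rel Carrier ℓ₂
  x ≤ y = ¬ (y < x)

  Converges : (ℕ → Carrier) → Carrier → Set (c ⊔ ℓ₂)
  Converges a s = ∀ ε → 0# < ε →
    ∃[ N ] (∀ t → N ℕ.≤ t → (a t - s < ε) × (s - a t < ε))

  -- |aₜ - aᵤ| < ε, with the absolute value expressed by exchanging t and u.
  Cauchy : (ℕ → Carrier) → Set (c ⊔ ℓ₂)
  Cauchy a = ∀ ε → 0# < ε →
    ∃[ N ] (∀ t u → N ℕ.≤ t → N ℕ.≤ u → a t - a u < ε)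

  field
    complete : ∀ a → Cauchy a → ∃[ s ] Converges a s

  HasSum : (ℕ → Carrier) → Carrier → Set (c ⊔ ℓ₂)
  HasSum a = Converges (λ t → sum {t} (a ∘ toℕ))

  open IsStrictPartialOrder isStrictPartialOrder public
    using (<-respʳ-≈; <-respˡ-≈)
    renaming (trans to <-trans; irrefl to <-irrefl)

  inv : ∀ {x} → 0# < x → Carrier
  inv {x} 0<x = proj₁ (#⇒invertible (Equivalence.from (#⇔<⊎> x 0#) (inj₂ 0<x)))

  0<1 : 0# < 1#
  0<1 with Equivalence.to (#⇔<⊎> 1# 0#) (HCR.1#0 heytingCommutativeRing)
  ... | inj₂ 0<1# = 0<1#
  ... | inj₁ 1<0  = <-respʳ-≈ -1*-1≈1 (*-pos 0<-1 0<-1)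
    where
    open RingProps (CommutativeRing.ring commutativeRing)
      using (-1*x≈-x; -‿involutive)
    0<-1 : 0# < - 1#
    0<-1 = <-respʳ-≈ (+-identityˡ (- 1#))
             (<-respˡ-≈ (-‿inverseʳ 1#) (+-monoˡ-< (- 1#) 1<0))
    -1*-1≈1 : - 1# * - 1# ≈ 1#
    -1*-1≈1 = trans (-1*x≈-x (- 1#)) (-‿involutive 1#)

  +-pos-nonneg : ∀ {x y} → 0# < x → 0# < y ⊎ y ≈ 0# → 0# < x + y
  +-pos-nonneg {x} {y} 0<x (inj₁ 0<y) =
    <-trans 0<y (<-respˡ-≈ (+-identityˡ y) (+-monoˡ-< y 0<x))
  +-pos-nonneg {x} {y} 0<x (inj₂ y≈0) =
    <-respʳ-≈ (sym (trans (+-congˡ y≈0) (+-identityʳ x))) 0<x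

  sum-nonneg : ∀ {n} (v : Vector Carrier n) →
               (∀ i → 0# < v i ⊎ v i ≈ 0#) → 0# < sum v ⊎ sum v ≈ 0#
  sum-nonneg {zero}  v v≥0 = inj₂ refl
  sum-nonneg {suc n} v v≥0 with v≥0 zero | sum-nonneg (v ∘ suc) (v≥0 ∘ suc)
  ... | inj₁ p | s      = inj₁ (+-pos-nonneg p s)
  ... | inj₂ e | inj₁ p = inj₁ (<-respʳ-≈ (+-comm _ _) (+-pos-nonneg p (inj₂ e)))
  ... | inj₂ e | inj₂ f = inj₂ (trans (+-cong e f) (+-identityˡ 0#))

  sum-pos : ∀ {n} (v : Vector Carrier n) →
            (∀ i → 0# < v i ⊎ v i ≈ 0#) → ∀ i → 0# < v i → 0# < sum v
  sum-pos v v≥0 zero    p = +-pos-nonneg p (sum-nonneg (v ∘ suc) (v≥0 ∘ suc))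
  sum-pos v v≥0 (suc i) p =
    <-respʳ-≈ (+-comm _ _) (+-pos-nonneg (sum-pos (v ∘ suc) (v≥0 ∘ suc) i p) (v≥0 zero))

  fromℕ-pos : ∀ n .{{_ : NonZero n}} → 0# < fromℕ n
  fromℕ-pos (suc zero)    = +-pos-nonneg 0<1 (inj₂ refl)
  fromℕ-pos (suc (suc n)) = +-pos-nonneg 0<1 (inj₁ (fromℕ-pos (suc n)))

  1/ : ∀ n .{{_ : NonZero n}} → Carrier
  1/ n = inv (fromℕ-pos n)

------------------------------------------------------------------------
-- Graphs

record SimpleGraph : Set₁ where
  infix 4 _~_
  field
    Vertex   : Set
    _~_      : Rel Vertex 0ℓ
    ~-sym    : Symmetric _~_
    ~-irrefl : Irreflexive _≡_ _~_
    _~?_     : Decidable _~_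

open SimpleGraph using (Vertex)

Connected : SimpleGraph → Set
Connected G = ∀ i j → Star (SimpleGraph._~_ G) i j

infix 4 _≅_

record _≅_ (G H : SimpleGraph) : Set where
  open SimpleGraph G using () renaming (_~_ to _~G_)
  open SimpleGraph H using () renaming (_~_ to _~H_)
  field
    bijection : Vertex G ↔ Vertex H
    adjacency : ∀ i j → i ~G j ⇔ (Inverse.to bijection i ~H Inverse.to bijection j)

Colorable : SimpleGraph → ℕ → Set
Colorable G r = Σ[ f ∈ (Vertex G → Fin r) ] (∀ {i j} → i ~ j → f i ≢ f j)
  where open SimpleGraph G using (_~_)

IsChromaticNumber : SimpleGraph → ℕ → Set
IsChromaticNumber G r = Colorable G r × (∀ s → Colorable G s → r ℕ.≤ s)

completeMultipartite : ∀ {p} → (Fin p → ℕ) → SimpleGraph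
completeMultipartite {p} size = record
  { Vertex   = Σ[ a ∈ Fin p ] Fin (size a)
  ; _~_      = λ u v → proj₁ u ≢ proj₁ v
  ; ~-sym    = λ u≢v v≡u → u≢v (≡.sym v≡u)
  ; ~-irrefl = λ u≡v u≢v → u≢v (≡.cong proj₁ u≡v)
  ; _~?_     = λ u v → ¬? (proj₁ u ≟F proj₁ v)
  }

IsCompleteBipartite : SimpleGraph → Set
IsCompleteBipartite G =
  Σ[ size ∈ (Fin 2 → ℕ) ] (∀ a → NonZero (size a)) × G ≅ completeMultipartite size

Turán : ∀ {r n} → r ∣ n → SimpleGraph
Turán {r} r∣n = completeMultipartite {r} (λ _ → quotient r∣n)

------------------------------------------------------------------------
-- Weighted graphs and Kemeny's constant

module Kemeny {c ℓ₁ ℓ₂} (ℝ : RealField c ℓ₁ ℓ₂) where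

  open RealField ℝ

  record WeightedGraph (n : ℕ) : Set (c ⊔ ℓ₁ ⊔ ℓ₂ ⊔ lsuc 0ℓ) where
    infix 4 _~_
    field
      _~_       : Rel (Fin n) 0ℓ
      ~-sym     : Symmetric _~_
      ~-irrefl  : Irreflexive _≡_ _~_
      _~?_      : Decidable _~_
      weight    : Fin n → Fin n → Carrier
      symmetric : ∀ i j → weight i j ≈ weight j i
      positive  : ∀ {i j} → i ~ j → 0# < weight i j
      vanishing : ∀ {i j} → ¬ (i ~ j) → weight i j ≈ 0#

    underlying : SimpleGraph
    underlying = record
      { Vertex   = Fin n
      ; _~_      = _~_
      ; ~-sym    = ~-sym
      ; ~-irrefl = ~-irrefl
      ; _~?_     = _~?_
      }

    field
      connected : Connected underlying

    degree : Fin n → Carrier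
    degree i = sum (weight i)

    Unweighted : Set ℓ₁
    Unweighted = ∀ {i j} → i ~ j → weight i j ≈ 1#

  open WeightedGraph using (underlying)

  degree-pos : ∀ {n} → 2 ℕ.≤ n → (G : WeightedGraph n) →
               ∀ i → 0# < WeightedGraph.degree G i
  degree-pos {n} 2≤n G i = firstStep (connected i (proj₁ (other 2≤n i))) (proj₂ (other 2≤n i))
    where
    open WeightedGraph G

    other : ∀ {m} → 2 ℕ.≤ m → (k : Fin m) → ∃[ j ] k ≢ j
    other (s≤s (s≤s z≤n)) zero    = suc zero , λ ()
    other (s≤s (s≤s z≤n)) (suc k) = zero , λ ()

    nonneg : ∀ j → 0# < weight i j ⊎ weight i j ≈ 0#
    nonneg j with i ~? j
    ... | yes p = inj₁ (positive p)
    ... | no ¬p = inj₂ (vanishing ¬p)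

    firstStep : ∀ {j} → Star _~_ i j → i ≢ j → 0# < degree i
    firstStep ε                i≢i = ⊥-elim (i≢i ≡.refl)
    firstStep (_◅_ {j = k} p _) _  = sum-pos (weight i) nonneg k (positive p)

  chromatic-nonZero : ∀ {n} → 2 ℕ.≤ n → (G : WeightedGraph n) →
                      ∀ {r} → IsChromaticNumber (underlying G) r → NonZero r
  chromatic-nonZero (s≤s _) G ((f , _) , _) = nonZeroIndex (f zero)

  module RandomWalk {n} (2≤n : 2 ℕ.≤ n) (G : WeightedGraph n) where

    open WeightedGraph G

    transition : Fin n → Fin n → Carrier
    transition i j = inv (degree-pos 2≤n G i) * weight i j

    record IsStationary (π : Fin n → Carrier) : Set (ℓ₁ ⊔ ℓ₂) where
      field
        nonnegative : ∀ i → 0# ≤ π i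
        total       : sum π ≈ 1#
        invariant   : ∀ j → sum (λ i → π i * transition i j) ≈ π j

    -- firstPassage t j i is the probability that, for the walk X started at
    -- X₀ = j, the first time s ≥ 1 with Xₛ = i is s = t: the total probability
    -- of the length-t paths from j to i whose intermediate vertices avoid i.
    firstPassage : ℕ → Fin n → Fin n → Carrier
    firstPassage zero          j i = 0#
    firstPassage (suc zero)    j i = transition j i
    firstPassage (suc (suc t)) j i =
      sum (λ k → if does (k ≟F i) then 0#
                 else transition j k * firstPassage (suc t) k i)

    -- The expectation of the first passage time (the return time if j = i).
    IsMeanFirstPassageTime : Fin n → Fin n → Carrier → Set (c ⊔ ℓ₂)
    IsMeanFirstPassageTime j i = HasSum (λ t → t times firstPassage t j i)

    -- The value is computed from one starting vertex; that it does not depend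
    -- on the choice is not built into the definition.
    record IsKemenyConstant (K : Carrier) : Set (c ⊔ ℓ₁ ⊔ ℓ₂) where
      field
        π            : Fin n → Carrier
        isStationary : IsStationary π
        m            : Fin n → Fin n → Carrier
        isMean       : ∀ j i → IsMeanFirstPassageTime j i (m j i)
        start        : Fin n
        value        : K ≈ sum (λ i → π i * m start i) - 1#

  open RandomWalk public using (IsKemenyConstant)

{-# OPTIONS --safe #-}

-- Write p for the weights divided by the total degree, π for the row sums of p
-- (the stationary distribution), and L for the Laplacian π − p.  The hitting
-- times hᵢ of a vertex i satisfy L hᵢ = π − δᵢ, so that
-- K(G) = Σᵢ πᵢ ⟨hᵢ , L hᵢ⟩.  For a proper colouring f with r nonempty classes,
-- of masses s, put gᵢ = (1/r) 1_{class of i} / s_{f i} − δᵢ / πᵢ.  As the classes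
-- are independent sets, expanding the quadratic form gives the identity
--   K(G) = n − 2 + 1/r + Σᵢ πᵢ ⟨hᵢ − gᵢ , L (hᵢ − gᵢ)⟩,
-- and L is positive semidefinite with kernel the constants.  Equality thus
-- means L gᵢ = π − δᵢ for all i; off the diagonal this makes vertices of
-- different colours adjacent, and for unit weights it compares class sizes.
--
-- Since _≤_ is a negation and _≈_ is tight, case distinctions on the sign of
-- finitely many reals are available under a double negation.

module Submission where

open import Algebra.Bundles using (CommutativeRing)
import Algebra.Apartness.Properties.HeytingCommutativeRing as HeytingRing
import Algebra.Properties.Ring as RingProperties
import Algebra.Properties.Semiring.Mult as SemiringMult
import Algebra.Properties.Semiring.Mult.TCOptimised as OptimisedMult
import Algebra.Properties.Semiring.Sum as SemiringSum
import Algebra.Solver.Ring as RingSolver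
open import Algebra.Solver.Ring.AlmostCommutativeRing using (fromCommutativeRing; _-Raw-AlmostCommutative⟶_)
open import Data.Bool.Base using (Bool; true; false; if_then_else_)
open import Data.Empty using (⊥-elim)
open import Data.Fin.Base using (Fin; zero; suc; toℕ; fromℕ<; punchOut)
open import Data.Fin.Permutation using (cast-id)
open import Data.Fin.Properties using (_≟_; any?; punchOut-injective; injective⇒≤; nonZeroIndex)
open import Data.Integer.Base as ℤ using (ℤ; -[1+_])
import Data.Integer.Properties as ℤ
open import Data.Maybe.Base using (Maybe; just; nothing)
open import Data.Nat.Base as ℕ using (ℕ; zero; suc; NonZero)
open import Data.Nat.Divisibility using (_∣_; divides)
import Data.Nat.Properties as ℕ
open import Data.Nat.Tactic.RingSolver using (solve-∀)
open import Data.Product.Base using (Σ-syntax; ∃-syntax; _×_; _,_; proj₁; proj₂)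
open import Data.Product.Function.Dependent.Propositional using (Σ-↔)
open import Data.Sum.Base as Sum using (_⊎_; inj₁; inj₂)
open import Function.Base using (_∘_; _$_; case_of_; _∋_)
open import Function.Bundles using (_⇔_; _↔_; Equivalence; Inverse; mk⇔; mk↔ₛ′)
open import Function.Construct.Composition using (_↔-∘_)
open import Function.Properties.Inverse using (↔-refl)
open import Relation.Binary.Construct.Closure.ReflexiveTransitive using (Star; ε; _◅_)
open import Relation.Binary.Definitions using (tri<; tri≈; tri>)
open import Relation.Binary.PropositionalEquality as ≡ using (_≡_; _≢_)
import Relation.Binary.Reasoning.Setoid as SetoidReasoning
open import Relation.Nullary.Decidable.Core using (does; yes; no)
open import Relation.Nullary.Negation.Core using (¬_)
open import Defs

-- The mean passage times are given only as sums of series. Their first-step equation is therefore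
-- obtained as a limit of recursions between partial sums, and the constant 1 in it is the
-- probability of ever reaching the target. That this probability is 1 is recurrence, proved by an
-- energy argument of its own. Kac's formula for the return times then gives δᵢ the coefficient 1 in
-- L hᵢ. As for gᵢ: expanding the energy of hᵢ - gᵢ leaves, besides ⟨hᵢ , L hᵢ⟩, only pairings of gᵢ
-- with L hᵢ and with L gᵢ, so any choice of gᵢ yields a lower bound for K(G). The coefficient of δᵢ
-- is such that L turns the second term into - δᵢ on the class of i, where i has no neighbours. With
-- an arbitrary factor ρ in place of 1/r the bound reads n - 2 + 2ρ - rρ², where r arises as Σᵢ πᵢ /
-- s_{f i}; it is largest at ρ = 1/r.

-- Ring normalisation with integer coefficients

module IntegerRingSolver {c ℓ} (R : CommutativeRing c ℓ) where

  open CommutativeRing R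
  open RingProperties ring
  open OptimisedMult semiring renaming (_×_ to _·_; ×-homo-+ to ·-homo-+; ×1-homo-* to ·1-homo-*)
  open SetoidReasoning setoid

  -- Coefficients are integers because equality of reals is undecidable, while the solver has to
  -- recognise equal coefficients. The optimised multiple sends 0 and 1 to `0#` and `1#` by
  -- computation, so these constants can be written directly in polynomials.
  ⟦_⟧ℤ : ℤ → Carrier
  ⟦ ℤ.+ n ⟧ℤ    = n · 1#
  ⟦ -[1+ n ] ⟧ℤ = - (suc n · 1#)

  private
    -homo : ∀ i → ⟦ ℤ.- i ⟧ℤ ≈ - ⟦ i ⟧ℤ
    -homo (ℤ.+ zero)  = sym -0#≈0#
    -homo (ℤ.+ suc n) = refl
    -homo -[1+ n ]    = sym (-‿involutive _)

    cancel : ∀ x y z → y - z ≈ (x + y) - (x + z)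
    cancel x y z = begin
      y - z                   ≈⟨ +-congʳ (xyx⁻¹≈y x y) ⟨
      x + y + - x + - z       ≈⟨ +-assoc (x + y) (- x) (- z) ⟩
      x + y + (- x + - z)     ≈⟨ +-congˡ (-‿+-comm x z) ⟩
      x + y + - (x + z)       ∎

    ⊖-homo : ∀ m n → ⟦ m ℤ.⊖ n ⟧ℤ ≈ m · 1# - n · 1#
    ⊖-homo m       zero    = sym (trans (+-congˡ -0#≈0#) (+-identityʳ _))
    ⊖-homo zero    (suc n) = sym (+-identityˡ _)
    ⊖-homo (suc m) (suc n) = begin
      ⟦ suc m ℤ.⊖ suc n ⟧ℤ          ≡⟨ ≡.cong ⟦_⟧ℤ (ℤ.[1+m]⊖[1+n]≡m⊖n m n) ⟩
      ⟦ m ℤ.⊖ n ⟧ℤ                  ≈⟨ ⊖-homo m n ⟩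
      m · 1# - n · 1#               ≈⟨ cancel 1# _ _ ⟩
      1# + m · 1# - (1# + n · 1#)   ≈⟨ +-cong (1+× m 1#) (-‿cong (1+× n 1#)) ⟨
      suc m · 1# - suc n · 1#       ∎

    +-homo : ∀ i j → ⟦ i ℤ.+ j ⟧ℤ ≈ ⟦ i ⟧ℤ + ⟦ j ⟧ℤ
    +-homo (ℤ.+ m)  (ℤ.+ n)  = ·-homo-+ 1# m n
    +-homo (ℤ.+ m)  -[1+ n ] = ⊖-homo m (suc n)
    +-homo -[1+ m ] (ℤ.+ n)  = trans (⊖-homo n (suc m)) (+-comm _ _)
    +-homo -[1+ m ] -[1+ n ] = begin
      - (suc (suc (m ℕ.+ n)) · 1#)        ≡⟨ ≡.cong (λ k → - (suc k · 1#)) (ℕ.+-suc m n) ⟨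
      - ((suc m ℕ.+ suc n) · 1#)          ≈⟨ -‿cong (·-homo-+ 1# (suc m) (suc n)) ⟩
      - (suc m · 1# + suc n · 1#)         ≈⟨ -‿+-comm _ _ ⟨
      - (suc m · 1#) + - (suc n · 1#)     ∎

    *-homo : ∀ i j → ⟦ i ℤ.* j ⟧ℤ ≈ ⟦ i ⟧ℤ * ⟦ j ⟧ℤ
    *-homo (ℤ.+ m) (ℤ.+ n) =
      trans (reflexive (≡.cong ⟦_⟧ℤ (≡.sym (ℤ.pos-* m n)))) (·1-homo-* m n)
    *-homo (ℤ.+ m) -[1+ n ] = begin
      ⟦ ℤ.+ m ℤ.* -[1+ n ] ⟧ℤ             ≡⟨ ≡.cong ⟦_⟧ℤ (ℤ.-◃n≡-n (m ℕ.* suc n)) ⟩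
      ⟦ ℤ.- ℤ.+ (m ℕ.* suc n) ⟧ℤ          ≈⟨ -homo (ℤ.+ (m ℕ.* suc n)) ⟩
      - ((m ℕ.* suc n) · 1#)              ≈⟨ -‿cong (·1-homo-* m (suc n)) ⟩
      - (m · 1# * (suc n · 1#))           ≈⟨ -‿distribʳ-* _ _ ⟩
      m · 1# * - (suc n · 1#)             ∎
    *-homo -[1+ m ] (ℤ.+ n) = begin
      ⟦ -[1+ m ] ℤ.* ℤ.+ n ⟧ℤ             ≡⟨ ≡.cong ⟦_⟧ℤ (ℤ.-◃n≡-n (suc m ℕ.* n)) ⟩
      ⟦ ℤ.- ℤ.+ (suc m ℕ.* n) ⟧ℤ          ≈⟨ -homo (ℤ.+ (suc m ℕ.* n)) ⟩
      - ((suc m ℕ.* n) · 1#)              ≈⟨ -‿cong (·1-homo-* (suc m) n) ⟩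
      - (suc m · 1# * (n · 1#))           ≈⟨ -‿distribˡ-* _ _ ⟩
      - (suc m · 1#) * (n · 1#)           ∎
    *-homo -[1+ m ] -[1+ n ] = begin
      (suc m ℕ.* suc n) · 1#              ≈⟨ ·1-homo-* (suc m) (suc n) ⟩
      suc m · 1# * (suc n · 1#)           ≈⟨ -‿involutive _ ⟨
      - - (suc m · 1# * (suc n · 1#))     ≈⟨ -‿cong (-‿distribˡ-* _ _) ⟩
      - (- (suc m · 1#) * (suc n · 1#))   ≈⟨ -‿distribʳ-* _ _ ⟩
      - (suc m · 1#) * - (suc n · 1#)     ∎

  morphism : ℤ.+-*-rawRing -Raw-AlmostCommutative⟶ fromCommutativeRing R
  morphism = record
    { ⟦_⟧    = ⟦_⟧ℤ
    ; +-homo = +-homo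
    ; *-homo = *-homo
    ; -‿homo = -homo
    ; 0-homo = refl
    ; 1-homo = refl
    }

  private
    _coeff≟_ : ∀ i j → Maybe (⟦ i ⟧ℤ ≈ ⟦ j ⟧ℤ)
    i coeff≟ j with i ℤ.≟ j
    ... | yes i≡j = just (reflexive (≡.cong ⟦_⟧ℤ i≡j))
    ... | no  _   = nothing

  open RingSolver ℤ.+-*-rawRing (fromCommutativeRing R) morphism _coeff≟_ public
    using (solve; con; _:=_; _:+_; _:*_; _:-_; :-_)

-- Finiteness of the index set is essential: the cases are settled one index at a time. Whenever the
-- goal is a negation, signs may thus be assumed known for all vertices at once.
¬¬-∀ : ∀ {ℓ n} {P : Fin n → Set ℓ} → (∀ i → ¬ ¬ P i) → ¬ ¬ (∀ i → P i)
¬¬-∀ {n = zero}  ¬¬p ¬∀ = ¬∀ λ ()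
¬¬-∀ {n = suc n} ¬¬p ¬∀ = ¬¬p zero λ p₀ → ¬¬-∀ (¬¬p ∘ suc) λ p₊ →
  ¬∀ λ { zero → p₀ ; (suc i) → p₊ i }

-- Order, inverses, finite sums and the Kronecker delta

module OrderedField {c ℓ₁ ℓ₂} (ℝ : RealField c ℓ₁ ℓ₂) where

  open RealField ℝ public
  open CommutativeRing commutativeRing public
    using (ring; semiring)
  open RingProperties ring public
  open SemiringSum semiring public
    using (∑-distrib-+; ∑-comm; sum-cong-≋; *-distribˡ-sum; *-distribʳ-sum; sum-replicate; sum-replicate-zero)
  open SemiringMult semiring public using (×-homo-+; ×1-homo-*; ×-assoc-*; ×-congʳ)
  open HeytingRing heytingCommutativeRing public using (invertibleˡ⇒#; x-0≈x)
  open IntegerRingSolver commutativeRing public using (solve; con; _:=_; _:+_; _:*_; _:-_; :-_)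
  open SetoidReasoning setoid

  -- Stronger than `0# ≤ x`, which is a mere negation: sums and products of such elements can be
  -- inspected by cases. For squares it is available only under a double negation.
  Nonneg : Carrier → Set _
  Nonneg x = 0# < x ⊎ x ≈ 0#

  ≈-stable : ∀ {x y} → ¬ ¬ (x ≈ y) → x ≈ y
  ≈-stable {x} {y} ¬¬x≈y = proj₁ (tight x y) λ x#y → ¬¬x≈y λ x≈y → #-irrefl x≈y x#y

  ¬<∧¬>⇒≈ : ∀ {x y} → ¬ (x < y) → ¬ (y < x) → x ≈ y
  ¬<∧¬>⇒≈ {x} {y} ¬x<y ¬y<x =
    proj₁ (tight x y) (Sum.[ ¬x<y , ¬y<x ] ∘ Equivalence.to (#⇔<⊎> x y))

  <-weakTri : ∀ x y → ¬ ¬ (x < y ⊎ x ≈ y ⊎ y < x)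
  <-weakTri x y ¬tri =
    ¬tri (inj₂ (inj₁ (¬<∧¬>⇒≈ (¬tri ∘ inj₁) (¬tri ∘ inj₂ ∘ inj₂))))

  <⇒0<- : ∀ {x y} → x < y → 0# < y - x
  <⇒0<- {x} {y} x<y = <-respˡ-≈ (-‿inverseʳ x) (+-monoˡ-< (- x) x<y)

  0<-⇒< : ∀ {x y} → 0# < y - x → x < y
  0<-⇒< {x} {y} 0<y-x =
    <-respˡ-≈ (+-identityˡ x)
      (<-respʳ-≈ (solve 2 (λ x y → y :- x :+ x := y) refl x y) (+-monoˡ-< x 0<y-x))

  +-pos : ∀ {x y} → 0# < x → 0# < y → 0# < x + y
  +-pos 0<x 0<y = +-pos-nonneg 0<x (inj₁ 0<y)

  +-mono-< : ∀ {x y u v} → x < y → u < v → x + u < y + v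
  +-mono-< {x} {y} {u} {v} x<y u<v = 0<-⇒< $
    <-respʳ-≈ (solve 4 (λ x y u v → y :- x :+ (v :- u) := y :+ v :- (x :+ u)) refl x y u v)
      (+-pos (<⇒0<- x<y) (<⇒0<- u<v))

  0≮0 : ∀ {x} → x ≈ 0# → ¬ (0# < x)
  0≮0 x≈0 0<x = <-irrefl (sym x≈0) 0<x

  nonneg⇒≮0 : ∀ {x} → Nonneg x → ¬ (x < 0#)
  nonneg⇒≮0 (inj₁ 0<x) x<0 = <-irrefl refl (<-trans 0<x x<0)
  nonneg⇒≮0 (inj₂ x≈0) x<0 = <-irrefl x≈0 x<0

  nonneg-resp : ∀ {x y} → x ≈ y → Nonneg x → Nonneg y
  nonneg-resp x≈y = Sum.map (<-respʳ-≈ x≈y) (trans (sym x≈y))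

  *-nonneg : ∀ {x y} → Nonneg x → Nonneg y → Nonneg (x * y)
  *-nonneg (inj₁ 0<x) (inj₁ 0<y) = inj₁ (*-pos 0<x 0<y)
  *-nonneg (inj₁ 0<x) (inj₂ y≈0) = inj₂ (trans (*-congˡ y≈0) (zeroʳ _))
  *-nonneg (inj₂ x≈0) _          = inj₂ (trans (*-congʳ x≈0) (zeroˡ _))

  -- Apartness amounts to invertibility of the difference, so one inverse witnesses both sides.
  #⇒-#0 : ∀ {x y} → x # y → x - y # 0#
  #⇒-#0 {x} {y} x#y = invertibleˡ⇒# (z , trans (*-congˡ (x-0≈x (x - y))) z[x-y]≈1)
    where
    z = proj₁ (#⇒invertible x#y)
    z[x-y]≈1 = proj₁ (proj₂ (#⇒invertible x#y))

  square-pos : ∀ {x} → x # 0# → 0# < x * x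
  square-pos {x} x#0 with Equivalence.to (#⇔<⊎> x 0#) x#0
  ... | inj₂ 0<x = *-pos 0<x 0<x
  ... | inj₁ x<0 =
    <-respʳ-≈ (solve 1 (λ x → (con ℤ.0ℤ :- x) :* (con ℤ.0ℤ :- x) := x :* x) refl x)
      (*-pos (<⇒0<- x<0) (<⇒0<- x<0))

  square-¬¬nonneg : ∀ x → ¬ ¬ Nonneg (x * x)
  square-¬¬nonneg x ¬nn = <-weakTri x 0# λ where
    (inj₁ x<0)        → ¬nn (inj₁ (square-pos (Equivalence.from (#⇔<⊎> x 0#) (inj₁ x<0))))
    (inj₂ (inj₁ x≈0)) → ¬nn (inj₂ (trans (*-congˡ x≈0) (zeroʳ x)))
    (inj₂ (inj₂ 0<x)) → ¬nn (inj₁ (*-pos 0<x 0<x))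

  *-inverseʳ : ∀ {x} (0<x : 0# < x) → x * inv 0<x ≈ 1#
  *-inverseʳ {x} 0<x = trans (*-congʳ (sym (x-0≈x x)))
    (proj₂ (proj₂ (#⇒invertible (Equivalence.from (#⇔<⊎> x 0#) (inj₂ 0<x)))))

  *-inverseˡ : ∀ {x} (0<x : 0# < x) → inv 0<x * x ≈ 1#
  *-inverseˡ 0<x = trans (*-comm _ _) (*-inverseʳ 0<x)

  -- An inverse `y` of `x` is apart from 0 and equals `y * y * x`, a product of positive factors;
  -- the sign of `y` is never asked for.
  inv-pos : ∀ {x} (0<x : 0# < x) → 0# < inv 0<x
  inv-pos {x} 0<x = <-respʳ-≈ y*y*x≈y (*-pos (square-pos y#0) 0<x)
    where
    y = inv 0<x
    y#0 : y # 0#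
    y#0 = invertibleˡ⇒# (x , trans (*-congˡ (x-0≈x y)) (*-inverseʳ 0<x))
    y*y*x≈y : y * y * x ≈ y
    y*y*x≈y = begin
      y * y * x     ≈⟨ *-assoc y y x ⟩
      y * (y * x)   ≈⟨ *-congˡ (*-inverseˡ 0<x) ⟩
      y * 1#        ≈⟨ *-identityʳ y ⟩
      y             ∎

  *-cancelˡ-pos : ∀ {x y z} → 0# < x → x * y ≈ x * z → y ≈ z
  *-cancelˡ-pos {x} {y} {z} 0<x xy≈xz = begin
    y                   ≈⟨ *-identityˡ y ⟨
    1# * y              ≈⟨ *-congʳ (*-inverseˡ 0<x) ⟨
    inv 0<x * x * y     ≈⟨ *-assoc _ x y ⟩
    inv 0<x * (x * y)   ≈⟨ *-congˡ xy≈xz ⟩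
    inv 0<x * (x * z)   ≈⟨ *-assoc _ x z ⟨
    inv 0<x * x * z     ≈⟨ *-congʳ (*-inverseˡ 0<x) ⟩
    1# * z              ≈⟨ *-identityˡ z ⟩
    z                   ∎

  nonneg-cancelˡ : ∀ {x y} → 0# < x → Nonneg (x * y) → Nonneg y
  nonneg-cancelˡ {x} {y} 0<x xy≥0 = nonneg-resp
    (trans (sym (*-assoc _ x y)) (trans (*-congʳ (*-inverseˡ 0<x)) (*-identityˡ y)))
    (*-nonneg (inj₁ (inv-pos 0<x)) xy≥0)

  x+x≈2x : ∀ x → x + x ≈ fromℕ 2 * x
  -- The coefficient is spelled as `fromℕ 2` unfolds, namely `1# + (1# + 0#)`.
  x+x≈2x x = solve 1 (λ x → x :+ x := (con ℤ.1ℤ :+ (con ℤ.1ℤ :+ con ℤ.0ℤ)) :* x) refl x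

  fromℕ-mono-< : ∀ {m n} → m ℕ.< n → fromℕ m < fromℕ n
  fromℕ-mono-< {m} {n} m<n = 0<-⇒< (<-respʳ-≈ n-m (fromℕ-pos (n ℕ.∸ m) {{ℕ.>-nonZero (ℕ.m<n⇒0<n∸m m<n)}}))
    where
    n-m : fromℕ (n ℕ.∸ m) ≈ fromℕ n - fromℕ m
    n-m = begin
      fromℕ (n ℕ.∸ m)                         ≈⟨ solve 2 (λ x y → x := x :+ y :- y) refl _ (fromℕ m) ⟩
      fromℕ (n ℕ.∸ m) + fromℕ m - fromℕ m     ≈⟨ +-congʳ (×-homo-+ 1# (n ℕ.∸ m) m) ⟨
      fromℕ (n ℕ.∸ m ℕ.+ m) - fromℕ m         ≡⟨ ≡.cong (λ k → fromℕ k - fromℕ m) (ℕ.m∸n+n≡m (ℕ.<⇒≤ m<n)) ⟩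
      fromℕ n - fromℕ m                       ∎

  fromℕ-injective : ∀ {m n} → fromℕ m ≈ fromℕ n → m ≡ n
  fromℕ-injective {m} {n} m≈n with ℕ.<-cmp m n
  ... | tri< m<n _ _ = ⊥-elim (<-irrefl m≈n (fromℕ-mono-< m<n))
  ... | tri≈ _ m≡n _ = m≡n
  ... | tri> _ _ n<m = ⊥-elim (<-irrefl (sym m≈n) (fromℕ-mono-< n<m))

  ∑-distrib-‿- : ∀ {n} (f g : Fin n → Carrier) → sum (λ i → f i - g i) ≈ sum f - sum g
  ∑-distrib-‿- f g = begin
    sum (λ i → f i - g i)                ≈⟨ ∑-distrib-+ f (λ i → - g i) ⟩
    sum f + sum (λ i → - g i)            ≈⟨ +-congˡ (sum-cong-≋ (λ i → -1*x≈-x (g i))) ⟨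
    sum f + sum (λ i → - 1# * g i)       ≈⟨ +-congˡ (*-distribˡ-sum (- 1#) g) ⟨
    sum f + - 1# * sum g                 ≈⟨ +-congˡ (-1*x≈-x (sum g)) ⟩
    sum f - sum g                        ∎

  δ : ∀ {n} → Fin n → Fin n → Carrier
  δ i j = if does (i ≟ j) then 1# else 0#

  δ-≡ : ∀ {n} {i j : Fin n} → i ≡ j → δ i j ≈ 1#
  δ-≡ {i = i} {j} i≡j with i ≟ j
  ... | yes _  = refl
  ... | no i≢j = ⊥-elim (i≢j i≡j)

  δ-≢ : ∀ {n} {i j : Fin n} → i ≢ j → δ i j ≈ 0#
  δ-≢ {i = i} {j} i≢j with i ≟ j
  ... | yes i≡j = ⊥-elim (i≢j i≡j)
  ... | no _    = refl

  δ-nonneg : ∀ {n} (i j : Fin n) → Nonneg (δ i j)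
  δ-nonneg i j with i ≟ j
  ... | yes _ = inj₁ 0<1
  ... | no  _ = inj₂ refl

  δ-sym : ∀ {n} (i j : Fin n) → δ i j ≈ δ j i
  δ-sym i j with i ≟ j
  ... | yes i≡j = sym (δ-≡ (≡.sym i≡j))
  ... | no i≢j  = sym (δ-≢ (i≢j ∘ ≡.sym))

  sum-δ : ∀ {n} (i : Fin n) (u : Fin n → Carrier) → sum (λ j → δ i j * u j) ≈ u i
  sum-δ {suc n} zero u = begin
    1# * u zero + sum {n} (λ j → 0# * u (suc j))  ≈⟨ +-cong (*-identityˡ _) (sum-cong-≋ (λ j → zeroˡ (u (suc j)))) ⟩
    u zero + sum {n} (λ _ → 0#)                   ≈⟨ +-congˡ (sum-replicate-zero n) ⟩
    u zero + 0#                                   ≈⟨ +-identityʳ _ ⟩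
    u zero                                        ∎
  sum-δ {suc n} (suc i) u = begin
    0# * u zero + sum (λ j → δ i j * u (suc j))   ≈⟨ +-cong (zeroˡ _) (sum-δ i (u ∘ suc)) ⟩
    0# + u (suc i)                                ≈⟨ +-identityˡ _ ⟩
    u (suc i)                                     ∎

-- The Laplacian of symmetric weights and its energy

module DirichletForms {c ℓ₁ ℓ₂} (ℝ : RealField c ℓ₁ ℓ₂) where

  open OrderedField ℝ
  open SetoidReasoning setoid

  module DirichletForm {n : ℕ}
    (p         : Fin n → Fin n → Carrier)
    (p-sym     : ∀ i j → p i j ≈ p j i)
    (p-nonneg  : ∀ i j → Nonneg (p i j))
    (_~_       : Fin n → Fin n → Set)
    (edge      : ∀ {i j} → i ~ j → 0# < p i j)
    (connected : ∀ i j → Star _~_ i j)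
    where

    infix 7 _∙_

    _∙_ : (u v : Fin n → Carrier) → Carrier
    u ∙ v = sum (λ j → u j * v j)

    -- Written with differences, so that constants vanish term by term and squares of differences
    -- appear in the energy; `L-expand` recovers the matrix form.
    L : (Fin n → Carrier) → Fin n → Carrier
    L u j = sum (λ k → p j k * (u j - u k))

    ∙-cong : ∀ {u v x y} → (∀ i → u i ≈ v i) → (∀ i → x i ≈ y i) → u ∙ x ≈ v ∙ y
    ∙-cong u≈v x≈y = sum-cong-≋ (λ i → *-cong (u≈v i) (x≈y i))

    L-expand : ∀ u j → L u j ≈ sum (p j) * u j - sum (λ k → p j k * u k)
    L-expand u j = begin
      sum (λ k → p j k * (u j - u k))                           ≈⟨ sum-cong-≋ (λ k → x[y-z]≈xy-xz (p j k) (u j) (u k)) ⟩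
      sum (λ k → p j k * u j - p j k * u k)                     ≈⟨ ∑-distrib-‿- (λ k → p j k * u j) (λ k → p j k * u k) ⟩
      sum (λ k → p j k * u j) - sum (λ k → p j k * u k)         ≈⟨ +-congʳ (*-distribʳ-sum (u j) (p j)) ⟨
      sum (p j) * u j - sum (λ k → p j k * u k)                 ∎

    L-distrib-‿- : ∀ u v j → L (λ i → u i - v i) j ≈ L u j - L v j
    L-distrib-‿- u v j = begin
      sum (λ k → p j k * (u j - v j - (u k - v k)))
        ≈⟨ sum-cong-≋ (λ k → solve 5 (λ p x y z w → p :* (x :- y :- (z :- w)) := p :* (x :- z) :- p :* (y :- w)) refl (p j k) (u j) (v j) (u k) (v k)) ⟩
      sum (λ k → p j k * (u j - u k) - p j k * (v j - v k))
        ≈⟨ ∑-distrib-‿- (λ k → p j k * (u j - u k)) (λ k → p j k * (v j - v k)) ⟩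
      L u j - L v j
        ∎

    L-linear : ∀ {m} (a : Fin m → Carrier) (u : Fin m → Fin n → Carrier) j →
               L (λ k → sum (λ i → a i * u i k)) j ≈ sum (λ i → a i * L (u i) j)
    L-linear a u j = begin
      sum (λ k → p j k * (sum (λ i → a i * u i j) - sum (λ i → a i * u i k)))
        ≈⟨ sum-cong-≋ (λ k → *-congˡ (∑-distrib-‿- (λ i → a i * u i j) (λ i → a i * u i k))) ⟨
      sum (λ k → p j k * sum (λ i → a i * u i j - a i * u i k))
        ≈⟨ sum-cong-≋ (λ k → *-distribˡ-sum (p j k) (λ i → a i * u i j - a i * u i k)) ⟩
      sum (λ k → sum (λ i → p j k * (a i * u i j - a i * u i k)))
        ≈⟨ ∑-comm (λ k i → p j k * (a i * u i j - a i * u i k)) ⟩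
      sum (λ i → sum (λ k → p j k * (a i * u i j - a i * u i k)))
        ≈⟨ sum-cong-≋ (λ i → sum-cong-≋ (λ k →
             solve 4 (λ p a x y → p :* (a :* x :- a :* y) := a :* (p :* (x :- y))) refl (p j k) (a i) (u i j) (u i k))) ⟩
      sum (λ i → sum (λ k → a i * (p j k * (u i j - u i k))))
        ≈⟨ sum-cong-≋ (λ i → *-distribˡ-sum (a i) (λ k → p j k * (u i j - u i k))) ⟨
      sum (λ i → a i * L (u i) j)
        ∎

    L-* : ∀ c u j → L (λ k → c * u k) j ≈ c * L u j
    L-* c u j = begin
      sum (λ k → p j k * (c * u j - c * u k))
        ≈⟨ sum-cong-≋ (λ k → solve 4 (λ p a x y → p :* (a :* x :- a :* y) := a :* (p :* (x :- y))) refl (p j k) c (u j) (u k)) ⟩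
      sum (λ k → c * (p j k * (u j - u k)))
        ≈⟨ *-distribˡ-sum c (λ k → p j k * (u j - u k)) ⟨
      c * L u j
        ∎

    L-const : ∀ u → (∀ j k → u j ≈ u k) → ∀ j → L u j ≈ 0#
    L-const u const j = begin
      sum (λ k → p j k * (u j - u k))   ≈⟨ sum-cong-≋ (λ k → trans (*-congˡ (x≈y⇒x∙y⁻¹≈ε (const j k))) (zeroʳ _)) ⟩
      sum {n} (λ _ → 0#)                ≈⟨ sum-replicate-zero n ⟩
      0#                                ∎

    private
      -- Twice the Dirichlet form: every pair of vertices is counted in both orders.
      form : (u v : Fin n → Carrier) → Carrier
      form u v = sum (λ j → sum (λ k → p j k * ((u j - u k) * (v j - v k))))

      -- The second copy of the double sum is taken with `j` and `k` exchanged; symmetry of `p` then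
      -- merges `u j` and `- u k` into a difference. Self-adjointness and positivity of `L` are both
      -- read off from the right-hand side.
      polarisation : ∀ u v → u ∙ L v + u ∙ L v ≈ form u v
      polarisation u v = begin
        u ∙ L v + u ∙ L v
          ≈⟨ +-cong expand (trans expand (∑-comm (λ j k → u j * (p j k * (v j - v k))))) ⟩
        sum (λ j → sum (λ k → u j * (p j k * (v j - v k)))) + sum (λ j → sum (λ k → u k * (p k j * (v k - v j))))
          ≈⟨ ∑-distrib-+ (λ j → sum (λ k → u j * (p j k * (v j - v k)))) _ ⟨
        sum (λ j → sum (λ k → u j * (p j k * (v j - v k))) + sum (λ k → u k * (p k j * (v k - v j))))
          ≈⟨ sum-cong-≋ (λ j → trans (sym (∑-distrib-+ (λ k → u j * (p j k * (v j - v k))) _)) (sum-cong-≋ (λ k → merge j k))) ⟩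
        form u v
          ∎
        where
        expand : u ∙ L v ≈ sum (λ j → sum (λ k → u j * (p j k * (v j - v k))))
        expand = sum-cong-≋ (λ j → *-distribˡ-sum (u j) (λ k → p j k * (v j - v k)))
        merge : ∀ j k → u j * (p j k * (v j - v k)) + u k * (p k j * (v k - v j)) ≈ p j k * ((u j - u k) * (v j - v k))
        merge j k = begin
          u j * (p j k * (v j - v k)) + u k * (p k j * (v k - v j))
            ≈⟨ +-congˡ (*-congˡ (*-congʳ (p-sym k j))) ⟩
          u j * (p j k * (v j - v k)) + u k * (p j k * (v k - v j))
            ≈⟨ solve 5 (λ p x y z w → x :* (p :* (z :- w)) :+ y :* (p :* (w :- z)) := p :* ((x :- y) :* (z :- w))) refl (p j k) (u j) (u k) (v j) (v k) ⟩
          p j k * ((u j - u k) * (v j - v k))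
            ∎

      double-cancel : ∀ {x y} → x + x ≈ y + y → x ≈ y
      double-cancel {x} {y} eq =
        *-cancelˡ-pos (fromℕ-pos 2) (trans (sym (x+x≈2x x)) (trans eq (x+x≈2x y)))

    L-selfAdjoint : ∀ u v → u ∙ L v ≈ v ∙ L u
    L-selfAdjoint u v = double-cancel (begin
      u ∙ L v + u ∙ L v   ≈⟨ polarisation u v ⟩
      form u v            ≈⟨ sum-cong-≋ (λ j → sum-cong-≋ (λ k → *-congˡ (*-comm (u j - u k) (v j - v k)))) ⟩
      form v u            ≈⟨ polarisation v u ⟨
      v ∙ L u + v ∙ L u   ∎)

    private
      squares : (Fin n → Carrier) → Set _
      squares u = ∀ j k → Nonneg ((u j - u k) * (u j - u k))

      ¬¬squares : ∀ u → ¬ ¬ squares u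
      ¬¬squares u = ¬¬-∀ (λ j → ¬¬-∀ (λ k → square-¬¬nonneg (u j - u k)))

      rows-nonneg : ∀ u → squares u → ∀ j → Nonneg (sum (λ k → p j k * ((u j - u k) * (u j - u k))))
      rows-nonneg u sq j = sum-nonneg _ (λ k → *-nonneg (p-nonneg j k) (sq j k))

    energy-nonneg : ∀ u → ¬ ¬ Nonneg (u ∙ L u)
    energy-nonneg u ¬nn = ¬¬squares u λ sq → ¬nn (nonneg-cancelˡ (fromℕ-pos 2)
      (nonneg-resp (trans (sym (polarisation u u)) (x+x≈2x _)) (sum-nonneg _ (rows-nonneg u sq))))

    -- If the two values were apart, the term of this edge would be positive, and with it the whole
    -- sum of nonnegative terms. Tightness turns the refuted apartness into equality.
    energy-zero⇒edge : ∀ u → u ∙ L u ≈ 0# → ∀ {j k} → 0# < p j k → u j ≈ u k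
    energy-zero⇒edge u E≈0 {j} {k} 0<p = proj₁ (tight _ _) λ uj#uk → ¬¬squares u λ sq →
      0≮0 form≈0 (sum-pos _ (rows-nonneg u sq) j
        (sum-pos _ (λ l → *-nonneg (p-nonneg j l) (sq j l)) k
          (*-pos 0<p (square-pos (#⇒-#0 uj#uk)))))
      where
      form≈0 : form u u ≈ 0#
      form≈0 = trans (sym (polarisation u u)) (trans (+-cong E≈0 E≈0) (+-identityˡ 0#))

    energy-zero⇒const : ∀ u → u ∙ L u ≈ 0# → ∀ j k → u j ≈ u k
    energy-zero⇒const u E≈0 j k = path (connected j k)
      where
      path : ∀ {j k} → Star _~_ j k → u j ≈ u k
      path ε       = refl
      path (e ◅ s) = trans (energy-zero⇒edge u E≈0 (edge e)) (path s)

    harmonic⇒const : ∀ u → (∀ j → L u j ≈ 0#) → ∀ j k → u j ≈ u k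
    harmonic⇒const u Lu≈0 = energy-zero⇒const u (begin
      u ∙ L u               ≈⟨ sum-cong-≋ (λ j → trans (*-congˡ (Lu≈0 j)) (zeroʳ (u j))) ⟩
      sum {n} (λ _ → 0#)    ≈⟨ sum-replicate-zero n ⟩
      0#                    ∎)

-- Limits of real sequences

module Limits {c ℓ₁ ℓ₂} (ℝ : RealField c ℓ₁ ℓ₂) where

  open OrderedField ℝ
  open SetoidReasoning setoid

  private
    half : Carrier → Carrier
    half x = 1/ 2 * x

    half-pos : ∀ {x} → 0# < x → 0# < half x
    half-pos = *-pos (inv-pos (fromℕ-pos 2))

    half+half : ∀ x → half x + half x ≈ x
    half+half x = begin
      half x + half x         ≈⟨ x+x≈2x (half x) ⟩
      fromℕ 2 * (1/ 2 * x)    ≈⟨ *-assoc _ _ x ⟨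
      fromℕ 2 * 1/ 2 * x      ≈⟨ *-congʳ (*-inverseʳ (fromℕ-pos 2)) ⟩
      1# * x                  ≈⟨ *-identityˡ x ⟩
      x                       ∎

  Converges-cong : ∀ {a b s t} → (∀ k → a k ≈ b k) → s ≈ t → Converges a s → Converges b t
  Converges-cong a≈b s≈t lim η 0<η with lim η 0<η
  ... | N , close = N , λ k N≤k →
    <-respˡ-≈ (+-cong (a≈b k) (-‿cong s≈t)) (proj₁ (close k N≤k)) ,
    <-respˡ-≈ (+-cong s≈t (-‿cong (a≈b k))) (proj₂ (close k N≤k))

  Converges-const : ∀ s → Converges (λ _ → s) s
  Converges-const s η 0<η = 0 , λ _ _ → s-s<η , s-s<η
    where s-s<η = <-respˡ-≈ (sym (-‿inverseʳ s)) 0<η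

  Converges-tail : ∀ {a s} → Converges a s → Converges (a ∘ suc) s
  Converges-tail lim η 0<η with lim η 0<η
  ... | N , close = N , λ k N≤k → close (suc k) (ℕ.m≤n⇒m≤1+n N≤k)

  Converges-neg : ∀ {a s} → Converges a s → Converges (λ k → - a k) (- s)
  Converges-neg {a} {s} lim η 0<η with lim η 0<η
  ... | N , close = N , λ k N≤k →
    <-respˡ-≈ (solve 2 (λ x y → y :- x := :- x :- (:- y)) refl (a k) s) (proj₂ (close k N≤k)) ,
    <-respˡ-≈ (solve 2 (λ x y → x :- y := :- y :- (:- x)) refl (a k) s) (proj₁ (close k N≤k))

  Converges-+ : ∀ {a b s t} → Converges a s → Converges b t → Converges (λ k → a k + b k) (s + t)
  Converges-+ {a} {b} {s} {t} lima limb η 0<η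
    with lima (half η) (half-pos 0<η) | limb (half η) (half-pos 0<η)
  ... | M , closea | N , closeb = M ℕ.⊔ N , λ k M⊔N≤k →
    let ca = closea k (ℕ.≤-trans (ℕ.m≤m⊔n M N) M⊔N≤k)
        cb = closeb k (ℕ.≤-trans (ℕ.m≤n⊔m M N) M⊔N≤k)
    in combine (a k) s (b k) t (proj₁ ca) (proj₁ cb) , combine s (a k) t (b k) (proj₂ ca) (proj₂ cb)
    where
    combine : ∀ x y u v → x - y < half η → u - v < half η → x + u - (y + v) < η
    combine x y u v p q =
      <-respˡ-≈ (solve 4 (λ x y u v → x :- y :+ (u :- v) := x :+ u :- (y :+ v)) refl x y u v)
        (<-respʳ-≈ (half+half η) (+-mono-< p q))

  -- The factor will be a transition probability, hence positive or zero; only in the first case can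
  -- the tolerance be divided by it.
  Converges-* : ∀ {c a s} → Nonneg c → Converges a s → Converges (λ k → c * a k) (c * s)
  Converges-* (inj₂ c≈0) lim =
    Converges-cong (λ _ → sym (trans (*-congʳ c≈0) (zeroˡ _))) (sym (trans (*-congʳ c≈0) (zeroˡ _))) (Converges-const 0#)
  Converges-* {c} {a} {s} (inj₁ 0<c) lim η 0<η with lim (inv 0<c * η) (*-pos (inv-pos 0<c) 0<η)
  ... | N , close = N , λ k N≤k →
    scale (a k) s (proj₁ (close k N≤k)) , scale s (a k) (proj₂ (close k N≤k))
    where
    scale : ∀ x y → x - y < inv 0<c * η → c * x - c * y < η
    scale x y x-y<η/c = 0<-⇒< (<-respʳ-≈ (begin
      c * (inv 0<c * η - (x - y))           ≈⟨ solve 5 (λ c d e x y → c :* (d :* e :- (x :- y)) := c :* d :* e :- (c :* x :- c :* y)) refl c (inv 0<c) η x y ⟩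
      c * inv 0<c * η - (c * x - c * y)     ≈⟨ +-congʳ (trans (*-congʳ (*-inverseʳ 0<c)) (*-identityˡ η)) ⟩
      η - (c * x - c * y)                   ∎) (*-pos 0<c (<⇒0<- x-y<η/c)))

  Converges-sum : ∀ {n} {a : Fin n → ℕ → Carrier} {s : Fin n → Carrier} →
                  (∀ i → Converges (a i) (s i)) → Converges (λ k → sum (λ i → a i k)) (sum s)
  Converges-sum {zero}  lim = Converges-const 0#
  Converges-sum {suc n} lim = Converges-+ (lim zero) (Converges-sum (lim ∘ suc))

  Converges-unique : ∀ {a s t} → Converges a s → Converges a t → s ≈ t
  Converges-unique lims limt = ¬<∧¬>⇒≈ (separated lims limt) (separated limt lims)
    where
    separated : ∀ {a s t} → Converges a s → Converges a t → ¬ (s < t)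
    separated {a} {s} {t} lims limt s<t
      with lims (half (t - s)) (half-pos (<⇒0<- s<t)) | limt (half (t - s)) (half-pos (<⇒0<- s<t))
    ... | M , closes | N , closet =
      <-irrefl refl (<-respˡ-≈ (solve 3 (λ a s t → a :- s :+ (t :- a) := t :- s) refl (a (M ℕ.⊔ N)) s t)
        (<-respʳ-≈ (half+half (t - s))
          (+-mono-< (proj₁ (closes _ (ℕ.m≤m⊔n M N))) (proj₂ (closet _ (ℕ.m≤n⊔m M N))))))

-- The random walk: stationarity, recurrence, hitting times and Kemeny's constant

module Walk {c ℓ₁ ℓ₂} (ℝ : RealField c ℓ₁ ℓ₂) where

  open OrderedField ℝ
  open DirichletForms ℝ
  open Limits ℝ
  open Kemeny ℝ
  open SetoidReasoning setoid

  module KemenyWalk {n : ℕ} (2≤n : 2 ℕ.≤ n) (G : WeightedGraph n) where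

    open WeightedGraph G
    open Kemeny.RandomWalk ℝ 2≤n G hiding (IsKemenyConstant)

    private
      weight-nonneg : ∀ i j → Nonneg (weight i j)
      weight-nonneg i j with i ~? j
      ... | yes i~j = inj₁ (positive i~j)
      ... | no ¬i~j = inj₂ (vanishing ¬i~j)

      v₀ : Fin n
      v₀ = fromℕ< (ℕ.≤-trans (ℕ.s≤s ℕ.z≤n) 2≤n)

    degree>0 : ∀ i → 0# < degree i
    degree>0 = degree-pos 2≤n G

    total>0 : 0# < sum degree
    total>0 = sum-pos degree (inj₁ ∘ degree>0) v₀ (degree>0 v₀)

    scale : Carrier
    scale = inv total>0

    scale>0 : 0# < scale
    scale>0 = inv-pos total>0

    p : Fin n → Fin n → Carrier
    p i j = scale * weight i j

    p-sym : ∀ i j → p i j ≈ p j i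
    p-sym i j = *-congˡ (symmetric i j)

    p-edge : ∀ {i j} → i ~ j → 0# < p i j
    p-edge i~j = *-pos scale>0 (positive i~j)

    p-nonedge : ∀ {i j} → ¬ (i ~ j) → p i j ≈ 0#
    p-nonedge ¬i~j = trans (*-congˡ (vanishing ¬i~j)) (zeroʳ scale)

    p-nonneg : ∀ i j → Nonneg (p i j)
    p-nonneg i j = *-nonneg (inj₁ scale>0) (weight-nonneg i j)

    open DirichletForm p p-sym p-nonneg _~_ p-edge connected public

    stat : Fin n → Carrier
    stat i = sum (p i)

    stat≈ : ∀ i → stat i ≈ scale * degree i
    stat≈ i = sym (*-distribˡ-sum scale (weight i))

    stat>0 : ∀ i → 0# < stat i
    stat>0 i = <-respʳ-≈ (sym (stat≈ i)) (*-pos scale>0 (degree>0 i))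

    stat-total : sum stat ≈ 1#
    stat-total = begin
      sum stat                         ≈⟨ sum-cong-≋ stat≈ ⟩
      sum (λ i → scale * degree i)     ≈⟨ *-distribˡ-sum scale degree ⟨
      scale * sum degree               ≈⟨ *-inverseˡ total>0 ⟩
      1#                               ∎

    -- Together with the symmetry of `p` this is detailed balance: the walk is reversible with
    -- respect to `stat`.
    stat-transition : ∀ i j → stat i * transition i j ≈ p i j
    stat-transition i j = begin
      stat i * (inv (degree>0 i) * weight i j)
        ≈⟨ *-congʳ (stat≈ i) ⟩
      scale * degree i * (inv (degree>0 i) * weight i j)
        ≈⟨ solve 4 (λ s d e w → s :* d :* (e :* w) := s :* (d :* e :* w)) refl scale (degree i) _ (weight i j) ⟩
      scale * (degree i * inv (degree>0 i) * weight i j)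
        ≈⟨ *-congˡ (trans (*-congʳ (*-inverseʳ (degree>0 i))) (*-identityˡ _)) ⟩
      scale * weight i j
        ∎

    transition-nonneg : ∀ i j → Nonneg (transition i j)
    transition-nonneg i j = *-nonneg (inj₁ (inv-pos (degree>0 i))) (weight-nonneg i j)

    transition-total : ∀ i → sum (transition i) ≈ 1#
    transition-total i =
      trans (sym (*-distribˡ-sum _ (weight i))) (*-inverseˡ (degree>0 i))

    -- In matrix form, `L` is diag(`stat`) times the identity minus the transition matrix. This is
    -- the bridge from step equations of the walk to equations for `L`.
    L-transition : ∀ u j → L u j ≈ stat j * (u j - sum (λ k → transition j k * u k))
    L-transition u j = begin
      L u j
        ≈⟨ L-expand u j ⟩
      stat j * u j - sum (λ k → p j k * u k)
        ≈⟨ +-congˡ (-‿cong (sum-cong-≋ (λ k → trans (*-congʳ (sym (stat-transition j k))) (*-assoc _ _ _)))) ⟩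
      stat j * u j - sum (λ k → stat j * (transition j k * u k))
        ≈⟨ +-congˡ (-‿cong (*-distribˡ-sum (stat j) (λ k → transition j k * u k))) ⟨
      stat j * u j - stat j * sum (λ k → transition j k * u k)
        ≈⟨ x[y-z]≈xy-xz _ _ _ ⟨
      stat j * (u j - sum (λ k → transition j k * u k))
        ∎

    -- By reversibility the density `y` of `π` with respect to `stat` is harmonic, hence constant;
    -- as both distributions have total 1, the constant is 1.
    stationary-unique : ∀ {π} → IsStationary π → ∀ i → π i ≈ stat i
    stationary-unique {π} isStat i = begin
      π i                          ≈⟨ stat*y i ⟨
      stat i * y i                 ≈⟨ *-congˡ (y≈1 i) ⟩
      stat i * 1#                  ≈⟨ *-identityʳ _ ⟩
      stat i                       ∎
      where
      open IsStationary isStat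
      y : Fin n → Carrier
      y i = inv (stat>0 i) * π i
      stat*y : ∀ i → stat i * y i ≈ π i
      stat*y i = trans (sym (*-assoc _ _ _)) (trans (*-congʳ (*-inverseʳ (stat>0 i))) (*-identityˡ _))
      flow : ∀ j k → p j k * y k ≈ π k * transition k j
      flow j k = begin
        p j k * y k                        ≈⟨ *-congʳ (trans (p-sym j k) (sym (stat-transition k j))) ⟩
        stat k * transition k j * y k      ≈⟨ solve 3 (λ s t y → s :* t :* y := s :* y :* t) refl _ _ _ ⟩
        stat k * y k * transition k j      ≈⟨ *-congʳ (stat*y k) ⟩
        π k * transition k j               ∎
      Ly≈0 : ∀ j → L y j ≈ 0#
      Ly≈0 j = begin
        L y j                                       ≈⟨ L-expand y j ⟩
        stat j * y j - sum (λ k → p j k * y k)      ≈⟨ +-cong (stat*y j) (-‿cong (trans (sum-cong-≋ (flow j)) (invariant j))) ⟩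
        π j - π j                                   ≈⟨ -‿inverseʳ _ ⟩
        0#                                          ∎
      y≈1 : ∀ i → y i ≈ 1#
      y≈1 i = begin
        y i                           ≈⟨ *-identityˡ _ ⟨
        1# * y i                      ≈⟨ *-congʳ stat-total ⟨
        sum stat * y i                ≈⟨ *-distribʳ-sum (y i) stat ⟩
        sum (λ k → stat k * y i)      ≈⟨ sum-cong-≋ (λ k → trans (*-congˡ (harmonic⇒const y Ly≈0 i k)) (stat*y k)) ⟩
        sum π                         ≈⟨ total ⟩
        1#                            ∎

    -- It uses the same Boolean test as `firstPassage`, so that the recursion there is an instance
    -- up to moving a factor through the `if`. Applied to mean passage times to `i`, it replaces the
    -- return time at `i` by 0.
    off : Fin n → (Fin n → Carrier) → Fin n → Carrier
    off i u k = if does (k ≟ i) then 0# else u k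

    off-≡ : ∀ i u → off i u i ≈ 0#
    off-≡ i u with i ≟ i
    ... | yes _  = refl
    ... | no i≢i = ⊥-elim (i≢i ≡.refl)

    off-δ : ∀ i u k → off i u k ≈ u k - δ i k * u i
    off-δ i u k with k ≟ i
    ... | yes ≡.refl = sym (trans (+-congˡ (-‿cong (trans (*-congʳ (δ-≡ {i = k} ≡.refl)) (*-identityˡ _)))) (-‿inverseʳ _))
    ... | no k≢i     = sym (trans (+-congˡ (trans (-‿cong (trans (*-congʳ (δ-≢ (k≢i ∘ ≡.sym))) (zeroˡ _))) -0#≈0#)) (+-identityʳ _))

    private
      -- The transition operator of the walk that is stopped on entering `i`.
      killed : Fin n → (Fin n → Carrier) → Fin n → Carrier
      killed i u j = sum (λ k → transition j k * off i u k)

      if-* : ∀ (b : Bool) {x y} → (if b then 0# else x * y) ≈ x * (if b then 0# else y)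
      if-* true  = sym (zeroʳ _)
      if-* false = refl

      if-sum : ∀ (b : Bool) {m} {g : Fin m → Carrier} →
               (if b then 0# else sum g) ≈ sum (λ t → if b then 0# else g t)
      if-sum true {m} = sym (sum-replicate-zero m)
      if-sum false    = refl

      if-times : ∀ (b : Bool) t {x} → (if b then 0# else t times x) ≈ t times (if b then 0# else x)
      if-times true t  = sym (trans (sym (sum-replicate t)) (sum-replicate-zero t))
      if-times false t = refl

      if-Converges : ∀ (b : Bool) {a s} → Converges a s →
                     Converges (λ k → if b then 0# else a k) (if b then 0# else s)
      if-Converges true  lim = Converges-const 0#
      if-Converges false lim = lim

    module _ (i : Fin n) where

      private
        f : ℕ → Fin n → Carrier
        f t j = firstPassage t j i

        f-step : ∀ t j → f (suc (suc t)) j ≈ killed i (f (suc t)) j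
        f-step t j = sum-cong-≋ (λ k → if-* (does (k ≟ i)))

        killed-sum : ∀ {m} (g : Fin m → Fin n → Carrier) j →
                     killed i (λ k → sum (λ t → g t k)) j ≈ sum (λ t → killed i (g t) j)
        killed-sum g j = begin
          sum (λ k → transition j k * off i (λ k → sum (λ t → g t k)) k)
            ≈⟨ sum-cong-≋ (λ k → trans (*-congˡ (if-sum (does (k ≟ i)) {g = λ t → g t k})) (*-distribˡ-sum _ (λ t → off i (g t) k))) ⟩
          sum (λ k → sum (λ t → transition j k * off i (g t) k))
            ≈⟨ ∑-comm (λ k t → transition j k * off i (g t) k) ⟩
          sum (λ t → killed i (g t) j)
            ∎

        times-* : ∀ t x y → t times (x * y) ≈ x * (t times y)
        times-* t x y = trans (×-congʳ t (*-comm x y)) (trans (sym (×-assoc-* t y x)) (*-comm _ x))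

        killed-times : ∀ t u j → t times killed i u j ≈ killed i (λ k → t times u k) j
        killed-times t u j = begin
          t times sum (λ k → transition j k * off i u k)
            ≈⟨ trans (×-congʳ t (sym (*-identityˡ _))) (trans (sym (×-assoc-* t 1# _)) (*-distribˡ-sum (fromℕ t) (λ k → transition j k * off i u k))) ⟩
          sum (λ k → fromℕ t * (transition j k * off i u k))
            ≈⟨ sum-cong-≋ (λ k → trans (×-assoc-* t 1# _) (trans (×-congʳ t (*-identityˡ _)) (trans (times-* t _ _) (*-congˡ (sym (if-times (does (k ≟ i)) t)))))) ⟩
          sum (λ k → transition j k * off i (λ k → t times u k) k)
            ∎

        moment : ℕ → Fin n → Carrier
        moment T j = sum {T} (λ t → toℕ t times f (toℕ t) j)

        -- The index is shifted since no first passage occurs at time 0: this is the probability of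
        -- reaching `i` at one of the times 1 to `T`.
        arrived : ℕ → Fin n → Carrier
        arrived T j = sum {T} (λ t → f (suc (toℕ t)) j)

        -- At time t + 1 the factor splits as 1 + t: the 1 produces `arrived`, and t times the
        -- passage probability at time t + 1 is one killed step applied to the term at time t.
        moment-step : ∀ T j → moment (suc T) j ≈ arrived T j + killed i (moment T) j
        moment-step T j = begin
          0# + sum {T} (λ t → f (suc (toℕ t)) j + toℕ t times f (suc (toℕ t)) j)
            ≈⟨ +-identityˡ _ ⟩
          sum {T} (λ t → f (suc (toℕ t)) j + toℕ t times f (suc (toℕ t)) j)
            ≈⟨ ∑-distrib-+ {T} (λ t → f (suc (toℕ t)) j) _ ⟩
          arrived T j + sum {T} (λ t → toℕ t times f (suc (toℕ t)) j)
            ≈⟨ +-congˡ (sum-cong-≋ {T} (λ t → step (toℕ t))) ⟩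
          arrived T j + sum {T} (λ t → killed i (λ k → toℕ t times f (toℕ t) k) j)
            ≈⟨ +-congˡ (killed-sum {T} (λ t k → toℕ t times f (toℕ t) k) j) ⟨
          arrived T j + killed i (moment T) j
            ∎
          where
          step : ∀ t → t times f (suc t) j ≈ killed i (λ k → t times f t k) j
          -- `f-step` does not relate times 0 and 1, but here the factor 0 makes both sides vanish.
          -- The zero is read as an empty sum to fit `if-sum`.
          step zero = sym (begin
            sum (λ k → transition j k * off i (λ _ → 0#) k)   ≈⟨ sum-cong-≋ (λ k → trans (*-congˡ (if-sum (does (k ≟ i)) {0} {λ ()})) (zeroʳ _)) ⟩
            sum {n} (λ _ → 0#)                                ≈⟨ sum-replicate-zero n ⟩
            0#                                                ∎)
          step (suc t) = trans (×-congʳ (suc t) (f-step t j)) (killed-times (suc t) (f (suc t)) j)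

        arrived-step : ∀ T j → arrived (suc T) j ≈ transition j i + killed i (arrived T) j
        arrived-step T j = +-congˡ (trans (sum-cong-≋ {T} (λ t → f-step (toℕ t) j)) (sym (killed-sum {T} (λ t → f (suc (toℕ t))) j)))

      module _ {m : Fin n → Carrier} (isMean : ∀ j → IsMeanFirstPassageTime j i (m j)) where

        private
          killed-lim : ∀ {a : ℕ → Fin n → Carrier} {s} → (∀ k → Converges (λ T → a T k) (s k)) →
                       ∀ j → Converges (λ T → killed i (a T) j) (killed i s j)
          killed-lim lim j = Converges-sum (λ k →
            Converges-* (transition-nonneg j k) (if-Converges (does (k ≟ i)) (lim k)))

          -- The probability of ever reaching `i`. Taking it as this difference makes `moment-step`
          -- deliver the convergence of `arrived` from that of the moments.
          φ : Fin n → Carrier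
          φ j = m j - killed i m j

          arrived-lim : ∀ j → Converges (λ T → arrived T j) (φ j)
          arrived-lim j = Converges-cong
            (λ T → trans (+-congʳ (moment-step T j)) (solve 2 (λ x y → x :+ y :- y := x) refl _ (killed i (moment T) j)))
            refl
            (Converges-+ (Converges-tail (isMean j)) (Converges-neg (killed-lim isMean j)))

          φ-step : ∀ j → φ j ≈ transition j i + killed i φ j
          φ-step j = Converges-unique (Converges-tail (arrived-lim j))
            (Converges-cong (λ T → sym (arrived-step T j)) refl
              (Converges-+ (Converges-const _) (killed-lim arrived-lim j)))

          -- The probability of never visiting i.
          e : Fin n → Carrier
          e j = 1# - φ j

          -- The constant 1 satisfies the same inhomogeneous equation as `φ`, because the transition
          -- probabilities from `j` add up to 1; the term `transition j i` cancels in the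
          -- difference.
          e-step : ∀ j → e j ≈ killed i e j
          e-step j = begin
            1# - φ j
              ≈⟨ +-cong (sym (transition-total j)) (-‿cong (φ-step j)) ⟩
            sum (transition j) - (transition j i + killed i φ j)
              ≈⟨ solve 3 (λ x y z → x :- (y :+ z) := x :- y :- z) refl _ _ _ ⟩
            sum (transition j) - transition j i - killed i φ j
              ≈⟨ +-congʳ (+-congˡ (-‿cong (sum-δ i (transition j)))) ⟨
            sum (transition j) - sum (λ k → δ i k * transition j k) - killed i φ j
              ≈⟨ +-congʳ (∑-distrib-‿- (transition j) _) ⟨
            sum (λ k → transition j k - δ i k * transition j k) - killed i φ j
              ≈⟨ ∑-distrib-‿- (λ k → transition j k - δ i k * transition j k) _ ⟨
            sum (λ k → transition j k - δ i k * transition j k - transition j k * off i φ k)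
              ≈⟨ sum-cong-≋ (λ k → begin
                transition j k - δ i k * transition j k - transition j k * off i φ k
                  ≈⟨ +-congˡ (-‿cong (*-congˡ (off-δ i φ k))) ⟩
                transition j k - δ i k * transition j k - transition j k * (φ k - δ i k * φ i)
                  ≈⟨ solve 4 (λ t d x y → t :- d :* t :- t :* (x :- d :* y) := t :* (con ℤ.1ℤ :- x :- d :* (con ℤ.1ℤ :- y))) refl (transition j k) (δ i k) (φ k) (φ i) ⟩
                transition j k * (e k - δ i k * e i)
                  ≈⟨ *-congˡ (off-δ i e k) ⟨
                transition j k * off i e k
                  ∎) ⟩
            killed i e j
              ∎

          ē : Fin n → Carrier
          ē = off i e

          -- Every term vanishes: at `i` the vector `ē` is 0, and elsewhere it agrees with `e`,
          -- which `e-step` identifies with the average of `ē` over one step, so that `L ē` is 0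
          -- there.
          ē-energy : ē ∙ L ē ≈ 0#
          ē-energy = begin
            sum (λ j → ē j * L ē j)   ≈⟨ sum-cong-≋ (λ j → trans (*-congˡ (trans (L-transition ē j) (*-congˡ (+-congˡ (-‿cong (sym (e-step j))))))) (vanish j)) ⟩
            sum {n} (λ _ → 0#)        ≈⟨ sum-replicate-zero n ⟩
            0#                        ∎
            where
            vanish : ∀ j → ē j * (stat j * (ē j - e j)) ≈ 0#
            vanish j with does (j ≟ i)
            ... | true  = zeroˡ _
            ... | false = trans (*-congˡ (trans (*-congˡ (-‿inverseʳ (e j))) (zeroʳ _))) (zeroʳ _)

          -- Recurrence: zero energy makes `ē` constant, with the value 0 that it has at `i`. One
          -- more use of `e-step` covers the start at `i` itself, where `ē` says nothing about `e`.
          e≈0 : ∀ j → e j ≈ 0#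
          e≈0 j = begin
            e j                                    ≈⟨ e-step j ⟩
            sum (λ k → transition j k * ē k)       ≈⟨ sum-cong-≋ (λ k → trans (*-congˡ (trans (energy-zero⇒const ē ē-energy k i) (off-≡ i e))) (zeroʳ _)) ⟩
            sum {n} (λ _ → 0#)                     ≈⟨ sum-replicate-zero n ⟩
            0#                                     ∎

        -- The inhomogeneous term is `φ j` by definition, and recurrence makes it 1.
        firstStep : ∀ j → m j ≈ 1# + sum (λ k → transition j k * off i m k)
        firstStep j = begin
          m j                                  ≈⟨ solve 2 (λ x y → x := con ℤ.1ℤ :- (con ℤ.1ℤ :- (x :- y)) :+ y) refl (m j) (killed i m j) ⟩
          1# - e j + killed i m j              ≈⟨ +-congʳ (+-congˡ (trans (-‿cong (e≈0 j)) -0#≈0#)) ⟩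
          1# + 0# + killed i m j               ≈⟨ +-congʳ (+-identityʳ 1#) ⟩
          1# + killed i m j                    ∎

    module FromMeans (m : Fin n → Fin n → Carrier)
                     (isMean : ∀ j i → IsMeanFirstPassageTime j i (m j i)) where

      h : Fin n → Fin n → Carrier
      h i = off i (λ j → m j i)

      private
        -- The first-step equation holds for the return time at `i`, whereas `h i` is 0 there; this
        -- discrepancy is the multiple of δ.
        Lh′ : ∀ i j → L (h i) j ≈ stat j - δ i j * (stat i * m i i)
        Lh′ i j = begin
          L (h i) j
            ≈⟨ L-transition (h i) j ⟩
          stat j * (h i j - sum (λ k → transition j k * h i k))
            ≈⟨ *-congˡ (+-cong (off-δ i (λ j → m j i) j) (-‿cong walk)) ⟩
          stat j * (m j i - δ i j * m i i - (m j i - 1#))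
            ≈⟨ solve 4 (λ s x d y → s :* (x :- d :* y :- (x :- con ℤ.1ℤ)) := s :- d :* (s :* y)) refl (stat j) (m j i) (δ i j) (m i i) ⟩
          stat j - δ i j * (stat j * m i i)
            ≈⟨ +-congˡ (-‿cong same) ⟩
          stat j - δ i j * (stat i * m i i)
            ∎
          where
          walk : sum (λ k → transition j k * h i k) ≈ m j i - 1#
          walk = trans (solve 1 (λ x → x := con ℤ.1ℤ :+ x :- con ℤ.1ℤ) refl _)
                   (+-congʳ (sym (firstStep i (λ j → isMean j i) j)))
          same : δ i j * (stat j * m i i) ≈ δ i j * (stat i * m i i)
          same with i ≟ j
          ... | yes ≡.refl = refl
          ... | no  _      = trans (zeroˡ _) (sym (zeroˡ _))

      -- Kac's formula. By self-adjointness the entries of `L (h i)` sum to 0, since `L` kills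
      -- constants; summing `Lh′` leaves 1 minus this product.
      stat*return : ∀ i → stat i * m i i ≈ 1#
      stat*return i = begin
        stat i * m i i
          ≈⟨ solve 2 (λ x y → x := y :- (y :- x)) refl (stat i * m i i) 1# ⟩
        1# - (1# - stat i * m i i)
          ≈⟨ +-congˡ (-‿cong (+-cong (sym stat-total) (-‿cong (sym (sum-δ i (λ _ → stat i * m i i)))))) ⟩
        1# - (sum stat - sum (λ j → δ i j * (stat i * m i i)))
          ≈⟨ +-congˡ (-‿cong (trans (sym (∑-distrib-‿- stat _)) (sum-cong-≋ (λ j → trans (sym (Lh′ i j)) (sym (*-identityˡ _)))))) ⟩
        1# - (λ _ → 1#) ∙ L (h i)
          ≈⟨ +-congˡ (-‿cong (trans (L-selfAdjoint (λ _ → 1#) (h i)) constant)) ⟩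
        1# - 0#
          ≈⟨ x-0≈x 1# ⟩
        1#
          ∎
        where
        constant : h i ∙ L (λ _ → 1#) ≈ 0#
        constant = trans (sum-cong-≋ (λ j → trans (*-congˡ (L-const (λ _ → 1#) (λ _ _ → refl) j)) (zeroʳ _)))
                     (sum-replicate-zero n)

      Lh : ∀ i j → L (h i) j ≈ stat j - δ i j
      Lh i j = trans (Lh′ i j) (+-congˡ (-‿cong (trans (*-congˡ (stat*return i)) (*-identityʳ _))))

      private
        -- The expected hitting time of a target drawn from `stat`.
        x : Fin n → Carrier
        x j = sum (λ i → stat i * h i j)

        -- Through `harmonic⇒const` this gives the random target lemma: `x` does not depend on the
        -- starting vertex.
        Lx≈0 : ∀ j → L x j ≈ 0#
        Lx≈0 j = begin
          L x j                                                           ≈⟨ L-linear stat h j ⟩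
          sum (λ i → stat i * L (h i) j)                                  ≈⟨ sum-cong-≋ (λ i → trans (*-congˡ (Lh i j)) (x[y-z]≈xy-xz _ _ _)) ⟩
          sum (λ i → stat i * stat j - stat i * δ i j)                    ≈⟨ ∑-distrib-‿- (λ i → stat i * stat j) _ ⟩
          sum (λ i → stat i * stat j) - sum (λ i → stat i * δ i j)        ≈⟨ +-cong (sym (*-distribʳ-sum (stat j) stat)) (-‿cong (trans (sum-cong-≋ (λ i → trans (*-comm _ _) (*-congʳ (δ-sym i j)))) (sum-δ j stat))) ⟩
          sum stat * stat j - stat j                                      ≈⟨ +-congʳ (trans (*-congʳ stat-total) (*-identityˡ _)) ⟩
          stat j - stat j                                                 ≈⟨ -‿inverseʳ _ ⟩
          0#                                                              ∎

        h∙Lh : ∀ i → h i ∙ L (h i) ≈ sum (λ j → stat j * h i j)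
        h∙Lh i = begin
          sum (λ j → h i j * L (h i) j)
            ≈⟨ sum-cong-≋ (λ j → trans (*-congˡ (Lh i j)) (solve 3 (λ h s d → h :* (s :- d) := s :* h :- d :* h) refl (h i j) (stat j) (δ i j))) ⟩
          sum (λ j → stat j * h i j - δ i j * h i j)
            ≈⟨ ∑-distrib-‿- (λ j → stat j * h i j) _ ⟩
          sum (λ j → stat j * h i j) - sum (λ j → δ i j * h i j)
            ≈⟨ +-congˡ (-‿cong (trans (sum-δ i (h i)) (off-≡ i (λ j → m j i)))) ⟩
          sum (λ j → stat j * h i j) - 0#
            ≈⟨ x-0≈x _ ⟩
          sum (λ j → stat j * h i j)
            ∎

      -- By Kac's formula the subtracted 1 is the return term of `v`, so the left side is `x v`. As
      -- `x` is constant it may be averaged over starts, and exchanging the sums produces the right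
      -- side of `h∙Lh` for each target.
      kemeny-energy : ∀ v → sum (λ i → stat i * m v i) - 1# ≈ sum (λ i → stat i * (h i ∙ L (h i)))
      kemeny-energy v = begin
        sum (λ i → stat i * m v i) - 1#
          ≈⟨ +-congˡ (-‿cong (trans (sum-δ v (λ i → stat i * m i i)) (stat*return v))) ⟨
        sum (λ i → stat i * m v i) - sum (λ i → δ v i * (stat i * m i i))
          ≈⟨ ∑-distrib-‿- (λ i → stat i * m v i) _ ⟨
        sum (λ i → stat i * m v i - δ v i * (stat i * m i i))
          ≈⟨ sum-cong-≋ (λ i → trans (+-congˡ (-‿cong (*-congʳ (δ-sym v i)))) (trans
               (solve 4 (λ s m d y → s :* m :- d :* (s :* y) := s :* (m :- d :* y)) refl (stat i) (m v i) (δ i v) (m i i))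
               (*-congˡ (sym (off-δ i (λ j → m j i) v))))) ⟩
        x v
          ≈⟨ trans (*-congʳ stat-total) (*-identityˡ _) ⟨
        sum stat * x v
          ≈⟨ *-distribʳ-sum (x v) stat ⟩
        sum (λ j → stat j * x v)
          ≈⟨ sum-cong-≋ (λ j → trans (*-congˡ (harmonic⇒const x Lx≈0 v j)) (*-distribˡ-sum (stat j) (λ i → stat i * h i j))) ⟩
        sum (λ j → sum (λ i → stat j * (stat i * h i j)))
          ≈⟨ ∑-comm (λ j i → stat j * (stat i * h i j)) ⟩
        sum (λ i → sum (λ j → stat j * (stat i * h i j)))
          ≈⟨ sum-cong-≋ (λ i → trans
               (sum-cong-≋ (λ j → solve 3 (λ a b c → a :* (b :* c) := b :* (a :* c)) refl (stat j) (stat i) (h i j)))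
               (trans (sym (*-distribˡ-sum (stat i) (λ j → stat j * h i j))) (*-congˡ (sym (h∙Lh i))))) ⟩
        sum (λ i → stat i * (h i ∙ L (h i)))
          ∎

    module FromKemeny {K : Carrier} (isK : IsKemenyConstant 2≤n G K) where

      open IsKemenyConstant isK renaming (start to j₀)
      open FromMeans m isMean public using (h; Lh)

      K≈energy : K ≈ sum (λ i → stat i * (h i ∙ L (h i)))
      K≈energy = begin
        K                                        ≈⟨ value ⟩
        sum (λ i → π i * m j₀ i) - 1#         ≈⟨ +-congʳ (sum-cong-≋ (λ i → *-congʳ (stationary-unique isStationary i))) ⟩
        sum (λ i → stat i * m j₀ i) - 1#      ≈⟨ FromMeans.kemeny-energy m isMean j₀ ⟩
        sum (λ i → stat i * (h i ∙ L (h i)))     ∎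

-- Test vectors from a colouring, the bound and its equality case

module ColouredWalks {c ℓ₁ ℓ₂} (ℝ : RealField c ℓ₁ ℓ₂) where

  open OrderedField ℝ
  open Kemeny ℝ
  open Walk ℝ
  open SetoidReasoning setoid

  module ColouredWalk {n : ℕ} (2≤n : 2 ℕ.≤ n) (G : WeightedGraph n) {r : ℕ}
    (f      : Fin n → Fin r)
    (proper : ∀ {i j} → WeightedGraph._~_ G i j → f i ≢ f j)
    (onto   : ∀ a → ∃[ i ] f i ≡ a)
    (ρ      : Carrier)
    (ρr≈1   : ρ * fromℕ r ≈ 1#)
    where

    open WeightedGraph G using (_~_; _~?_)
    open KemenyWalk 2≤n G

    mass : Fin r → Carrier
    mass a = sum (λ j → δ a (f j) * stat j)

    mass>0 : ∀ a → 0# < mass a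
    mass>0 a with onto a
    ... | i , ≡.refl = sum-pos _ (λ j → *-nonneg (δ-nonneg a (f j)) (inj₁ (stat>0 j))) i
          (<-respʳ-≈ (sym (trans (*-congʳ (δ-≡ {i = a} ≡.refl)) (*-identityˡ _))) (stat>0 i))

    χ : Fin n → Fin n → Carrier
    χ i j = δ (f i) (f j)

    mass⁻¹ : Fin n → Carrier
    mass⁻¹ i = inv (mass>0 (f i))

    stat⁻¹ : Fin n → Carrier
    stat⁻¹ i = inv (stat>0 i)

    g : Fin n → Fin n → Carrier
    g i j = ρ * mass⁻¹ i * χ i j - stat⁻¹ i * δ i j

    -- The stationary flow from `j` into the class of `i`, that is, the off-diagonal part of
    -- `L (χ i)` up to sign.
    toClass : Fin n → Fin n → Carrier
    toClass i j = sum (λ k → p j k * χ i k)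

    toClass-nonneg : ∀ i j → Nonneg (toClass i j)
    toClass-nonneg i j = sum-nonneg _ (λ k → *-nonneg (p-nonneg j k) (δ-nonneg (f i) (f k)))

    same-class⇒p≈0 : ∀ {i j} → f i ≡ f j → p i j ≈ 0#
    same-class⇒p≈0 fi≡fj = p-nonedge (λ i~j → proper i~j fi≡fj)

    same-class⇒toClass≈0 : ∀ {i j} → f i ≡ f j → toClass i j ≈ 0#
    same-class⇒toClass≈0 {i} {j} fi≡fj = trans (sum-cong-≋ vanish) (sum-replicate-zero n)
      where
      vanish : ∀ k → p j k * χ i k ≈ 0#
      vanish k with f i ≟ f k
      ... | yes fi≡fk = trans (*-congʳ (same-class⇒p≈0 (≡.trans (≡.sym fi≡fj) fi≡fk))) (zeroˡ _)
      ... | no  _     = zeroʳ _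

    Lg : ∀ i j → L (g i) j ≈
      ρ * mass⁻¹ i * (stat j * χ i j - toClass i j) - stat⁻¹ i * (stat j * δ i j - p j i)
    Lg i j = begin
      L (g i) j
        ≈⟨ L-distrib-‿- (λ k → ρ * mass⁻¹ i * χ i k) (λ k → stat⁻¹ i * δ i k) j ⟩
      L (λ k → ρ * mass⁻¹ i * χ i k) j - L (λ k → stat⁻¹ i * δ i k) j
        ≈⟨ +-cong (L-* _ (χ i) j) (-‿cong (L-* _ (δ i) j)) ⟩
      ρ * mass⁻¹ i * L (χ i) j - stat⁻¹ i * L (δ i) j
        ≈⟨ +-cong (*-congˡ (L-expand (χ i) j)) (-‿cong (*-congˡ (trans (L-expand (δ i) j)
             (+-congˡ (-‿cong (trans (sum-cong-≋ (λ k → *-comm (p j k) (δ i k))) (sum-δ i (p j)))))))) ⟩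
      ρ * mass⁻¹ i * (stat j * χ i j - toClass i j) - stat⁻¹ i * (stat j * δ i j - p j i)
        ∎

    Lg-same : ∀ {i j} → f i ≡ f j → L (g i) j ≈ ρ * mass⁻¹ i * stat j - δ i j
    Lg-same {i} {j} fi≡fj = begin
      L (g i) j
        ≈⟨ Lg i j ⟩
      ρ * mass⁻¹ i * (stat j * χ i j - toClass i j) - stat⁻¹ i * (stat j * δ i j - p j i)
        ≈⟨ +-cong (*-congˡ (+-cong (*-congˡ (δ-≡ fi≡fj)) (-‿cong (same-class⇒toClass≈0 fi≡fj))))
                  (-‿cong (*-congˡ (+-cong diagonal (-‿cong (same-class⇒p≈0 (≡.sym fi≡fj)))))) ⟩
      ρ * mass⁻¹ i * (stat j * 1# - 0#) - stat⁻¹ i * (stat i * δ i j - 0#)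
        ≈⟨ solve 5 (λ x y z w d → x :* (y :* con ℤ.1ℤ :- con ℤ.0ℤ) :- z :* (w :* d :- con ℤ.0ℤ) := x :* y :- z :* w :* d) refl (ρ * mass⁻¹ i) (stat j) (stat⁻¹ i) (stat i) (δ i j) ⟩
      ρ * mass⁻¹ i * stat j - stat⁻¹ i * stat i * δ i j
        ≈⟨ +-congˡ (-‿cong (trans (*-congʳ (*-inverseˡ (stat>0 i))) (*-identityˡ _))) ⟩
      ρ * mass⁻¹ i * stat j - δ i j
        ∎
      where
      diagonal : stat j * δ i j ≈ stat i * δ i j
      diagonal with i ≟ j
      ... | yes ≡.refl = refl
      ... | no  _      = trans (zeroʳ _) (sym (zeroʳ _))

    Lg-other : ∀ {i j} → f i ≢ f j → L (g i) j ≈ stat⁻¹ i * p j i - ρ * mass⁻¹ i * toClass i j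
    Lg-other {i} {j} fi≢fj = begin
      L (g i) j
        ≈⟨ Lg i j ⟩
      ρ * mass⁻¹ i * (stat j * χ i j - toClass i j) - stat⁻¹ i * (stat j * δ i j - p j i)
        ≈⟨ +-cong (*-congˡ (+-congʳ (*-congˡ (δ-≢ fi≢fj))))
                  (-‿cong (*-congˡ (+-congʳ (*-congˡ (δ-≢ (fi≢fj ∘ ≡.cong f)))))) ⟩
      ρ * mass⁻¹ i * (stat j * 0# - toClass i j) - stat⁻¹ i * (stat j * 0# - p j i)
        ≈⟨ solve 5 (λ x y z w d → x :* (y :* con ℤ.0ℤ :- w) :- z :* (y :* con ℤ.0ℤ :- d) := z :* d :- x :* w) refl (ρ * mass⁻¹ i) (stat j) (stat⁻¹ i) (toClass i j) (p j i) ⟩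
      stat⁻¹ i * p j i - ρ * mass⁻¹ i * toClass i j
        ∎

    g∙ : ∀ i φ → g i ∙ φ ≈ ρ * mass⁻¹ i * (χ i ∙ φ) - stat⁻¹ i * φ i
    g∙ i φ = begin
      sum (λ j → (ρ * mass⁻¹ i * χ i j - stat⁻¹ i * δ i j) * φ j)
        ≈⟨ sum-cong-≋ (λ j → solve 5 (λ a x b d y → (a :* x :- b :* d) :* y := a :* (x :* y) :- b :* (d :* y)) refl (ρ * mass⁻¹ i) (χ i j) (stat⁻¹ i) (δ i j) (φ j)) ⟩
      sum (λ j → ρ * mass⁻¹ i * (χ i j * φ j) - stat⁻¹ i * (δ i j * φ j))
        ≈⟨ ∑-distrib-‿- (λ j → ρ * mass⁻¹ i * (χ i j * φ j)) _ ⟩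
      sum (λ j → ρ * mass⁻¹ i * (χ i j * φ j)) - sum (λ j → stat⁻¹ i * (δ i j * φ j))
        ≈⟨ +-cong (*-distribˡ-sum _ (λ j → χ i j * φ j)) (-‿cong (trans (*-congˡ (sym (sum-δ i φ))) (*-distribˡ-sum _ (λ j → δ i j * φ j)))) ⟨
      ρ * mass⁻¹ i * (χ i ∙ φ) - stat⁻¹ i * φ i
        ∎

    module Bound {K : Carrier} (isK : IsKemenyConstant 2≤n G K) where

      open FromKemeny isK

      bound : Carrier
      bound = fromℕ n - fromℕ 2 + ρ

      u : Fin n → Fin n → Carrier
      u i j = h i j - g i j

      Energy : Fin n → Carrier
      Energy i = u i ∙ L (u i)

      private
        g∙Lh : ∀ i → g i ∙ L (h i) ≈ ρ - ρ * mass⁻¹ i - 1# + stat⁻¹ i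
        g∙Lh i = begin
          g i ∙ L (h i)
            ≈⟨ ∙-cong (λ _ → refl) (Lh i) ⟩
          g i ∙ (λ j → stat j - δ i j)
            ≈⟨ g∙ i (λ j → stat j - δ i j) ⟩
          ρ * mass⁻¹ i * (χ i ∙ (λ j → stat j - δ i j)) - stat⁻¹ i * (stat i - δ i i)
            ≈⟨ +-cong (*-congˡ χ∙) (-‿cong (*-congˡ (+-congˡ (-‿cong (δ-≡ {i = i} ≡.refl))))) ⟩
          ρ * mass⁻¹ i * (mass (f i) - 1#) - stat⁻¹ i * (stat i - 1#)
            ≈⟨ solve 5 (λ ρ a s b t → ρ :* a :* (s :- con ℤ.1ℤ) :- b :* (t :- con ℤ.1ℤ) := ρ :* (a :* s) :- ρ :* a :- b :* t :+ b) refl ρ (mass⁻¹ i) (mass (f i)) (stat⁻¹ i) (stat i) ⟩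
          ρ * (mass⁻¹ i * mass (f i)) - ρ * mass⁻¹ i - stat⁻¹ i * stat i + stat⁻¹ i
            ≈⟨ +-congʳ (+-cong (+-congʳ (trans (*-congˡ (*-inverseˡ (mass>0 (f i)))) (*-identityʳ ρ))) (-‿cong (*-inverseˡ (stat>0 i)))) ⟩
          ρ - ρ * mass⁻¹ i - 1# + stat⁻¹ i
            ∎
          where
          χ∙ : χ i ∙ (λ j → stat j - δ i j) ≈ mass (f i) - 1#
          χ∙ = begin
            sum (λ j → χ i j * (stat j - δ i j))
              ≈⟨ sum-cong-≋ (λ j → solve 3 (λ x y z → x :* (y :- z) := x :* y :- z :* x) refl (χ i j) (stat j) (δ i j)) ⟩
            sum (λ j → χ i j * stat j - δ i j * χ i j)
              ≈⟨ ∑-distrib-‿- (λ j → χ i j * stat j) _ ⟩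
            mass (f i) - sum (λ j → δ i j * χ i j)
              ≈⟨ +-congˡ (-‿cong (trans (sum-δ i (χ i)) (δ-≡ {i = f i} ≡.refl))) ⟩
            mass (f i) - 1#
              ∎

        -- As `g i` is supported on the colour class of `i`, only `Lg-same` enters, and flows
        -- between different classes do not appear.
        g∙Lg : ∀ i → g i ∙ L (g i) ≈ ρ * ρ * mass⁻¹ i - (ρ * mass⁻¹ i + ρ * mass⁻¹ i) + stat⁻¹ i
        g∙Lg i = begin
          g i ∙ L (g i)
            ≈⟨ g∙ i (L (g i)) ⟩
          ρ * mass⁻¹ i * (χ i ∙ L (g i)) - stat⁻¹ i * L (g i) i
            ≈⟨ +-cong (*-congˡ χ∙) (-‿cong (*-congˡ (trans (Lg-same {i} ≡.refl) (+-congˡ (-‿cong (δ-≡ {i = i} ≡.refl)))))) ⟩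
          ρ * mass⁻¹ i * (ρ - 1#) - stat⁻¹ i * (ρ * mass⁻¹ i * stat i - 1#)
            ≈⟨ solve 4 (λ ρ a b s → ρ :* a :* (ρ :- con ℤ.1ℤ) :- b :* (ρ :* a :* s :- con ℤ.1ℤ) := ρ :* ρ :* a :- (ρ :* a :+ ρ :* a :* (b :* s)) :+ b) refl ρ (mass⁻¹ i) (stat⁻¹ i) (stat i) ⟩
          ρ * ρ * mass⁻¹ i - (ρ * mass⁻¹ i + ρ * mass⁻¹ i * (stat⁻¹ i * stat i)) + stat⁻¹ i
            ≈⟨ +-congʳ (+-congˡ (-‿cong (+-congˡ (trans (*-congˡ (*-inverseˡ (stat>0 i))) (*-identityʳ _))))) ⟩
          ρ * ρ * mass⁻¹ i - (ρ * mass⁻¹ i + ρ * mass⁻¹ i) + stat⁻¹ i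
            ∎
          where
          term : ∀ j → χ i j * L (g i) j ≈ ρ * mass⁻¹ i * (χ i j * stat j) - δ i j * 1#
          term j = case f i ≟ f j of λ where
            (yes fi≡fj) → begin
              χ i j * L (g i) j
                ≈⟨ *-cong (δ-≡ fi≡fj) (Lg-same fi≡fj) ⟩
              1# * (ρ * mass⁻¹ i * stat j - δ i j)
                ≈⟨ solve 3 (λ a s d → con ℤ.1ℤ :* (a :* s :- d) := a :* (con ℤ.1ℤ :* s) :- d :* con ℤ.1ℤ) refl (ρ * mass⁻¹ i) (stat j) (δ i j) ⟩
              ρ * mass⁻¹ i * (1# * stat j) - δ i j * 1#
                ≈⟨ +-congʳ (*-congˡ (*-congʳ (δ-≡ fi≡fj))) ⟨
              ρ * mass⁻¹ i * (χ i j * stat j) - δ i j * 1#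
                ∎
            (no fi≢fj) → begin
              χ i j * L (g i) j
                ≈⟨ trans (*-congʳ (δ-≢ fi≢fj)) (zeroˡ _) ⟩
              0#
                ≈⟨ solve 2 (λ a s → con ℤ.0ℤ := a :* (con ℤ.0ℤ :* s) :- con ℤ.0ℤ :* con ℤ.1ℤ) refl (ρ * mass⁻¹ i) (stat j) ⟩
              ρ * mass⁻¹ i * (0# * stat j) - 0# * 1#
                ≈⟨ +-cong (*-congˡ (*-congʳ (δ-≢ fi≢fj))) (-‿cong (*-congʳ (δ-≢ (fi≢fj ∘ ≡.cong f)))) ⟨
              ρ * mass⁻¹ i * (χ i j * stat j) - δ i j * 1#
                ∎
          χ∙ : χ i ∙ L (g i) ≈ ρ - 1#
          χ∙ = begin
            sum (λ j → χ i j * L (g i) j)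
              ≈⟨ sum-cong-≋ term ⟩
            sum (λ j → ρ * mass⁻¹ i * (χ i j * stat j) - δ i j * 1#)
              ≈⟨ ∑-distrib-‿- (λ j → ρ * mass⁻¹ i * (χ i j * stat j)) _ ⟩
            sum (λ j → ρ * mass⁻¹ i * (χ i j * stat j)) - sum (λ j → δ i j * 1#)
              ≈⟨ +-cong (sym (*-distribˡ-sum _ (λ j → χ i j * stat j))) (-‿cong (sum-δ i (λ _ → 1#))) ⟩
            ρ * mass⁻¹ i * mass (f i) - 1#
              ≈⟨ +-congʳ (trans (*-assoc _ _ _) (trans (*-congˡ (*-inverseˡ (mass>0 (f i)))) (*-identityʳ ρ))) ⟩
            ρ - 1#
              ∎

        Lu : ∀ i j → L (u i) j ≈ L (h i) j - L (g i) j
        Lu i = L-distrib-‿- (h i) (g i)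

        Energy-expand : ∀ i → Energy i ≈ h i ∙ L (h i) - (g i ∙ L (h i) + g i ∙ L (h i)) + g i ∙ L (g i)
        Energy-expand i = begin
          u i ∙ L (u i)
            ≈⟨ ∙-cong (λ _ → refl) (Lu i) ⟩
          sum (λ j → (h i j - g i j) * (L (h i) j - L (g i) j))
            ≈⟨ sum-cong-≋ (λ j → solve 4 (λ h g a b → (h :- g) :* (a :- b) := h :* a :- (g :* a :+ h :* b) :+ g :* b) refl (h i j) (g i j) (L (h i) j) (L (g i) j)) ⟩
          sum (λ j → h i j * L (h i) j - (g i j * L (h i) j + h i j * L (g i) j) + g i j * L (g i) j)
            ≈⟨ ∑-distrib-+ (λ j → h i j * L (h i) j - (g i j * L (h i) j + h i j * L (g i) j)) _ ⟩
          sum (λ j → h i j * L (h i) j - (g i j * L (h i) j + h i j * L (g i) j)) + g i ∙ L (g i)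
            ≈⟨ +-congʳ (trans (∑-distrib-‿- (λ j → h i j * L (h i) j) _) (+-congˡ (-‿cong (trans (∑-distrib-+ (λ j → g i j * L (h i) j) _) (+-congˡ (L-selfAdjoint (h i) (g i))))))) ⟩
          h i ∙ L (h i) - (g i ∙ L (h i) + g i ∙ L (h i)) + g i ∙ L (g i)
            ∎

        -- The reciprocals of `stat i` combine to a single one with negative sign, which the factor
        -- `stat i` turns into -1: this is one vertex's share of the n in the bound.
        stat*Energy : ∀ i → stat i * Energy i ≈
          stat i * (h i ∙ L (h i)) + ((fromℕ 2 - fromℕ 2 * ρ) * stat i - 1# + ρ * ρ * (stat i * mass⁻¹ i))
        stat*Energy i = begin
          stat i * Energy i
            ≈⟨ *-congˡ (trans (Energy-expand i) (+-cong (+-congˡ (-‿cong (+-cong (g∙Lh i) (g∙Lh i)))) (g∙Lg i))) ⟩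
          stat i * (h i ∙ L (h i) - (ρ - ρ * mass⁻¹ i - 1# + stat⁻¹ i + (ρ - ρ * mass⁻¹ i - 1# + stat⁻¹ i)) + (ρ * ρ * mass⁻¹ i - (ρ * mass⁻¹ i + ρ * mass⁻¹ i) + stat⁻¹ i))
            ≈⟨ solve 5 (λ s e ρ a b → s :* (e :- (ρ :- ρ :* a :- con ℤ.1ℤ :+ b :+ (ρ :- ρ :* a :- con ℤ.1ℤ :+ b)) :+ (ρ :* ρ :* a :- (ρ :* a :+ ρ :* a) :+ b))
                 := s :* e :+ ((two :- two :* ρ) :* s :- s :* b :+ ρ :* ρ :* (s :* a))) refl (stat i) (h i ∙ L (h i)) ρ (mass⁻¹ i) (stat⁻¹ i) ⟩
          stat i * (h i ∙ L (h i)) + ((fromℕ 2 - fromℕ 2 * ρ) * stat i - stat i * stat⁻¹ i + ρ * ρ * (stat i * mass⁻¹ i))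
            ≈⟨ +-congˡ (+-congʳ (+-congˡ (-‿cong (*-inverseʳ (stat>0 i))))) ⟩
          stat i * (h i ∙ L (h i)) + ((fromℕ 2 - fromℕ 2 * ρ) * stat i - 1# + ρ * ρ * (stat i * mass⁻¹ i))
            ∎
          where two = con ℤ.1ℤ :+ (con ℤ.1ℤ :+ con ℤ.0ℤ)

        -- Grouped by colour, each class contributes its mass divided by its mass.
        Σ-stat*mass⁻¹ : sum (λ i → stat i * mass⁻¹ i) ≈ fromℕ r
        Σ-stat*mass⁻¹ = begin
          sum (λ i → stat i * mass⁻¹ i)
            ≈⟨ sum-cong-≋ (λ i → sum-δ (f i) (λ a → stat i * inv (mass>0 a))) ⟨
          sum (λ i → sum (λ a → δ (f i) a * (stat i * inv (mass>0 a))))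
            ≈⟨ ∑-comm (λ i a → δ (f i) a * (stat i * inv (mass>0 a))) ⟩
          sum (λ a → sum (λ i → δ (f i) a * (stat i * inv (mass>0 a))))
            ≈⟨ sum-cong-≋ (λ a → trans
                 (sum-cong-≋ (λ i → trans (*-congʳ (δ-sym (f i) a)) (sym (*-assoc _ _ _))))
                 (trans (sym (*-distribʳ-sum (inv (mass>0 a)) (λ i → δ a (f i) * stat i))) (*-inverseʳ (mass>0 a)))) ⟩
          sum {r} (λ _ → 1#)
            ≈⟨ sum-replicate r ⟩
          fromℕ r
            ∎

      K≈bound+energy : K ≈ bound + sum (λ i → stat i * Energy i)
      K≈bound+energy = begin
        K
          -- Split off so that the bracket is `K` plus the constants of `stat*Energy` summed over
          -- all vertices; its last ρ stands for ρ² r.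
          ≈⟨ solve 3 (λ K n ρ → K := n :- two :+ ρ :+ (K :+ ((two :- two :* ρ) :* con ℤ.1ℤ :- n :+ ρ))) refl K (fromℕ n) ρ ⟩
        bound + (K + ((fromℕ 2 - fromℕ 2 * ρ) * 1# - fromℕ n + ρ))
          ≈⟨ +-congˡ (+-cong K≈energy (+-cong (+-cong (*-congˡ (sym stat-total)) (-‿cong (sym (sum-replicate n)))) ρ≈)) ⟩
        bound + (sum (λ i → stat i * (h i ∙ L (h i))) + (t * sum stat - sum {n} (λ _ → 1#) + ρ * ρ * sum (λ i → stat i * mass⁻¹ i)))
          ≈⟨ +-congˡ (+-congˡ (+-cong (+-congʳ (*-distribˡ-sum t stat)) (*-distribˡ-sum (ρ * ρ) (λ i → stat i * mass⁻¹ i)))) ⟩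
        bound + (sum (λ i → stat i * (h i ∙ L (h i))) + (sum (λ i → t * stat i) - sum {n} (λ _ → 1#) + sum (λ i → ρ * ρ * (stat i * mass⁻¹ i))))
          ≈⟨ +-congˡ (+-congˡ (+-congʳ (∑-distrib-‿- (λ i → t * stat i) (λ _ → 1#)))) ⟨
        bound + (sum (λ i → stat i * (h i ∙ L (h i))) + (sum (λ i → t * stat i - 1#) + sum (λ i → ρ * ρ * (stat i * mass⁻¹ i))))
          ≈⟨ +-congˡ (+-congˡ (∑-distrib-+ (λ i → t * stat i - 1#) _)) ⟨
        bound + (sum (λ i → stat i * (h i ∙ L (h i))) + sum (λ i → t * stat i - 1# + ρ * ρ * (stat i * mass⁻¹ i)))
          ≈⟨ +-congˡ (trans (sum-cong-≋ stat*Energy) (∑-distrib-+ (λ i → stat i * (h i ∙ L (h i))) _)) ⟨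
        bound + sum (λ i → stat i * Energy i)
          ∎
        where
        two = con ℤ.1ℤ :+ (con ℤ.1ℤ :+ con ℤ.0ℤ)
        t = fromℕ 2 - fromℕ 2 * ρ
        ρ≈ : ρ ≈ ρ * ρ * sum (λ i → stat i * mass⁻¹ i)
        ρ≈ = begin
          ρ                                              ≈⟨ *-identityʳ ρ ⟨
          ρ * 1#                                         ≈⟨ *-congˡ ρr≈1 ⟨
          ρ * (ρ * fromℕ r)                              ≈⟨ *-assoc _ _ _ ⟨
          ρ * ρ * fromℕ r                                ≈⟨ *-congˡ Σ-stat*mass⁻¹ ⟨
          ρ * ρ * sum (λ i → stat i * mass⁻¹ i)          ∎

      private
        ¬¬energies : ¬ ¬ (∀ i → Nonneg (stat i * Energy i))
        ¬¬energies ¬nn = ¬¬-∀ (λ i → energy-nonneg (u i)) λ nn →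
          ¬nn (λ i → *-nonneg (inj₁ (stat>0 i)) (nn i))

      bound≤K : bound ≤ K
      bound≤K K<bound = ¬¬energies λ nn → nonneg⇒≮0 (sum-nonneg _ nn)
        (<-respʳ-≈ (-‿inverseʳ bound) (<-respˡ-≈ total (+-monoˡ-< (- bound) K<bound)))
        where
        total : K - bound ≈ sum (λ i → stat i * Energy i)
        total = trans (+-congʳ K≈bound+energy) (solve 2 (λ x y → x :+ y :- x := y) refl bound _)

      -- The energies, nonnegative up to double negation, have a vanishing sum with positive
      -- weights, so each is 0. Then `h i` and `g i` differ by a constant, which `L` does not see.
      tight⇒Lg : K ≈ bound → ∀ i j → L (g i) j ≈ stat j - δ i j
      tight⇒Lg K≈bound i j = begin
        L (g i) j                               ≈⟨ solve 2 (λ x y → x := y :- (y :- x)) refl (L (g i) j) (L (h i) j) ⟩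
        L (h i) j - (L (h i) j - L (g i) j)     ≈⟨ +-congˡ (-‿cong (trans (sym (Lu i j)) (L-const (u i) const j))) ⟩
        L (h i) j - 0#                          ≈⟨ x-0≈x _ ⟩
        L (h i) j                               ≈⟨ Lh i j ⟩
        stat j - δ i j                          ∎
        where
        total≈0 : sum (λ i → stat i * Energy i) ≈ 0#
        total≈0 = begin
          sum (λ i → stat i * Energy i)                     ≈⟨ solve 2 (λ x y → x := y :+ x :- y) refl _ bound ⟩
          bound + sum (λ i → stat i * Energy i) - bound     ≈⟨ +-congʳ K≈bound+energy ⟨
          K - bound                                         ≈⟨ x≈y⇒x∙y⁻¹≈ε K≈bound ⟩
          0#                                                ∎
        energy≈0 : Energy i ≈ 0#
        energy≈0 = ≈-stable λ E≉0 → ¬¬-∀ (λ i → energy-nonneg (u i)) λ nn → split (nn i) E≉0 nn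
          where
          split : Nonneg (Energy i) → ¬ (Energy i ≈ 0#) → ¬ (∀ i → Nonneg (Energy i))
          split (inj₂ E≈0) E≉0 nn = E≉0 E≈0
          split (inj₁ 0<E) E≉0 nn = 0≮0 total≈0
            (sum-pos _ (λ i → *-nonneg (inj₁ (stat>0 i)) (nn i)) i (*-pos (stat>0 i) 0<E))
        const : ∀ j k → u i j ≈ u i k
        const = energy-zero⇒const (u i) energy≈0

      Lg⇒tight : (∀ i j → L (g i) j ≈ stat j - δ i j) → K ≈ bound
      Lg⇒tight Lg≈ = begin
        K                                               ≈⟨ K≈bound+energy ⟩
        bound + sum (λ i → stat i * Energy i)           ≈⟨ +-congˡ (trans (sum-cong-≋ (λ i → trans (*-congˡ (energy≈0 i)) (zeroʳ _))) (sum-replicate-zero n)) ⟩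
        bound + 0#                                      ≈⟨ +-identityʳ bound ⟩
        bound                                           ∎
        where
        energy≈0 : ∀ i → Energy i ≈ 0#
        energy≈0 i = trans (sum-cong-≋ (λ j → trans (*-congˡ (trans (Lu i j)
          (x≈y⇒x∙y⁻¹≈ε (trans (Lh i j) (sym (Lg≈ i j)))))) (zeroʳ _))) (sum-replicate-zero n)

      mass≈ρ⇒ρ/mass≈1 : (∀ a → mass a ≈ ρ) → ∀ i → ρ * mass⁻¹ i ≈ 1#
      mass≈ρ⇒ρ/mass≈1 mass≈ρ i = trans (*-congʳ (sym (mass≈ρ (f i)))) (*-inverseʳ (mass>0 (f i)))

      -- Read off from the diagonal entry of `tight⇒Lg` at a vertex `i` of the class: after
      -- cancelling δ, it says that `ρ * mass⁻¹ i` scales `stat i` to itself.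
      tight⇒mass≈ρ : K ≈ bound → ∀ a → mass a ≈ ρ
      tight⇒mass≈ρ K≈bound a with onto a
      ... | i , ≡.refl = begin
        mass a                              ≈⟨ *-identityʳ _ ⟨
        mass a * 1#                         ≈⟨ *-congˡ ρ/mass ⟨
        mass a * (ρ * mass⁻¹ i)             ≈⟨ solve 3 (λ s ρ t → s :* (ρ :* t) := ρ :* (s :* t)) refl (mass a) ρ (mass⁻¹ i) ⟩
        ρ * (mass a * mass⁻¹ i)             ≈⟨ *-congˡ (*-inverseʳ (mass>0 a)) ⟩
        ρ * 1#                              ≈⟨ *-identityʳ ρ ⟩
        ρ                                   ∎
        where
        ρ/mass : ρ * mass⁻¹ i ≈ 1#
        ρ/mass = *-cancelˡ-pos (stat>0 i) (begin
          stat i * (ρ * mass⁻¹ i)                    ≈⟨ solve 3 (λ s a d → s :* a := a :* s :- d :+ d) refl (stat i) (ρ * mass⁻¹ i) (δ i i) ⟩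
          ρ * mass⁻¹ i * stat i - δ i i + δ i i      ≈⟨ +-congʳ (Lg-same {i} ≡.refl) ⟨
          L (g i) i + δ i i                          ≈⟨ +-congʳ (tight⇒Lg K≈bound i i) ⟩
          stat i - δ i i + δ i i                     ≈⟨ solve 2 (λ s d → s :- d :+ d := s :* con ℤ.1ℤ) refl (stat i) (δ i i) ⟩
          stat i * 1#                                ∎)

      -- An entry of `tight⇒Lg` outside the class of `i`, cleared of the denominator `stat i`. As
      -- the left side is positive, `p j i` cannot vanish; this forces the edges in `tight⇒edge`.
      tight⇒flow : K ≈ bound → ∀ {i j} → f i ≢ f j → stat i * (stat j + toClass i j) ≈ p j i
      tight⇒flow K≈bound {i} {j} fi≢fj = begin
        stat i * (stat j + toClass i j)
          ≈⟨ *-congˡ (+-cong (trans (sym (x-0≈x _)) (+-congˡ (-‿cong (sym (δ-≢ (fi≢fj ∘ ≡.cong f)))))) (trans (sym (*-identityˡ _)) (*-congʳ (sym (mass≈ρ⇒ρ/mass≈1 (tight⇒mass≈ρ K≈bound) i))))) ⟩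
        stat i * (stat j - δ i j + ρ * mass⁻¹ i * toClass i j)
          ≈⟨ *-congˡ (+-congʳ (trans (sym (tight⇒Lg K≈bound i j)) (Lg-other fi≢fj))) ⟩
        stat i * (stat⁻¹ i * p j i - ρ * mass⁻¹ i * toClass i j + ρ * mass⁻¹ i * toClass i j)
          ≈⟨ solve 4 (λ s t x y → s :* (t :* x :- y :+ y) := s :* t :* x) refl (stat i) (stat⁻¹ i) (p j i) (ρ * mass⁻¹ i * toClass i j) ⟩
        stat i * stat⁻¹ i * p j i
          ≈⟨ trans (*-congʳ (*-inverseʳ (stat>0 i))) (*-identityˡ _) ⟩
        p j i
          ∎

      mass∧flow⇒tight : (∀ a → mass a ≈ ρ) → (∀ {i j} → f i ≢ f j → stat i * (stat j + toClass i j) ≈ p j i) → K ≈ bound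
      mass∧flow⇒tight mass≈ρ flow = Lg⇒tight λ i j → case f i ≟ f j of λ where
        (yes fi≡fj) → trans (Lg-same fi≡fj) (+-congʳ (trans (*-congʳ (mass≈ρ⇒ρ/mass≈1 mass≈ρ i)) (*-identityˡ _)))
        (no fi≢fj)  → begin
          L (g i) j
            ≈⟨ Lg-other fi≢fj ⟩
          stat⁻¹ i * p j i - ρ * mass⁻¹ i * toClass i j
            ≈⟨ +-cong (*-congˡ (flow fi≢fj)) (-‿cong (trans (sym (*-identityˡ _)) (*-congʳ (sym (mass≈ρ⇒ρ/mass≈1 mass≈ρ i))))) ⟨
          stat⁻¹ i * (stat i * (stat j + toClass i j)) - toClass i j
            ≈⟨ +-congʳ (trans (sym (*-assoc _ _ _)) (trans (*-congʳ (*-inverseˡ (stat>0 i))) (*-identityˡ _))) ⟩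
          stat j + toClass i j - toClass i j
            ≈⟨ solve 2 (λ x y → x :+ y :- y := x :- con ℤ.0ℤ) refl (stat j) (toClass i j) ⟩
          stat j - 0#
            ≈⟨ +-congˡ (-‿cong (δ-≢ (fi≢fj ∘ ≡.cong f))) ⟨
          stat j - δ i j
            ∎

      tight⇒edge : K ≈ bound → ∀ {i j} → f i ≢ f j → i ~ j
      tight⇒edge K≈bound {i} {j} fi≢fj with i ~? j
      ... | yes i~j = i~j
      ... | no ¬i~j = ⊥-elim (0≮0 (trans (tight⇒flow K≈bound fi≢fj) (trans (p-sym j i) (p-nonedge ¬i~j)))
                        (*-pos (stat>0 i) (+-pos-nonneg (stat>0 j) (toClass-nonneg i j))))

-- Enumerating and counting colour classes

count : ∀ {n r} → (Fin n → Fin r) → Fin r → ℕ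
count {zero}  f a = 0
count {suc n} f a = if does (a ≟ f zero) then suc (count (f ∘ suc) a) else count (f ∘ suc) a

count≤n : ∀ {n r} (f : Fin n → Fin r) a → count f a ℕ.≤ n
count≤n {zero}  f a = ℕ.z≤n
count≤n {suc n} f a with a ≟ f zero
... | yes _ = ℕ.s≤s (count≤n (f ∘ suc) a)
... | no  _ = ℕ.m≤n⇒m≤1+n (count≤n (f ∘ suc) a)

element : ∀ {n r} (f : Fin n → Fin r) a → Fin (count f a) → Fin n
element {suc n} f a k with a ≟ f zero
element {suc n} f a zero    | yes _ = zero
element {suc n} f a (suc k) | yes _ = suc (element (f ∘ suc) a k)
element {suc n} f a k       | no  _ = suc (element (f ∘ suc) a k)

element-colour : ∀ {n r} (f : Fin n → Fin r) a k → f (element f a k) ≡ a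
element-colour {suc n} f a k with a ≟ f zero
element-colour {suc n} f a zero    | yes a≡f₀ = ≡.sym a≡f₀
element-colour {suc n} f a (suc k) | yes _    = element-colour (f ∘ suc) a k
element-colour {suc n} f a k       | no  _    = element-colour (f ∘ suc) a k

index : ∀ {n r} (f : Fin n → Fin r) a i → f i ≡ a → Fin (count f a)
index {suc n} f a i       fi≡a with a ≟ f zero
index {suc n} f a zero    fi≡a | yes _    = zero
index {suc n} f a (suc i) fi≡a | yes _    = suc (index (f ∘ suc) a i fi≡a)
index {suc n} f a zero    fi≡a | no a≢f₀  = ⊥-elim (a≢f₀ (≡.sym fi≡a))
index {suc n} f a (suc i) fi≡a | no _     = index (f ∘ suc) a i fi≡a

element-index : ∀ {n r} (f : Fin n → Fin r) a i fi≡a → element f a (index f a i fi≡a) ≡ i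
element-index {suc n} f a i       fi≡a with a ≟ f zero
element-index {suc n} f a zero    fi≡a | yes _   = ≡.refl
element-index {suc n} f a (suc i) fi≡a | yes _   = ≡.cong suc (element-index (f ∘ suc) a i fi≡a)
element-index {suc n} f a zero    fi≡a | no a≢f₀ = ⊥-elim (a≢f₀ (≡.sym fi≡a))
element-index {suc n} f a (suc i) fi≡a | no _    = ≡.cong suc (element-index (f ∘ suc) a i fi≡a)

index-element : ∀ {n r} (f : Fin n → Fin r) a k fi≡a → index f a (element f a k) fi≡a ≡ k
index-element {suc n} f a k       fi≡a with a ≟ f zero
index-element {suc n} f a zero    fi≡a | yes _ = ≡.refl
index-element {suc n} f a (suc k) fi≡a | yes _ = ≡.cong suc (index-element (f ∘ suc) a k fi≡a)
index-element {suc n} f a k       fi≡a | no _  = index-element (f ∘ suc) a k fi≡a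

Fin↔fibres : ∀ {n r} (f : Fin n → Fin r) → Fin n ↔ (Σ[ a ∈ Fin r ] Fin (count f a))
Fin↔fibres f = mk↔ₛ′ (λ i → f i , index f (f i) i ≡.refl) (λ (a , k) → element f a k)
  (λ (a , k) → glue (element f a k) (element-colour f a k) (index-element f a k (element-colour f a k)))
  (λ i → element-index f (f i) i ≡.refl)
  where
  -- Vertex and colour are generalised here so that the colour equation can be matched with `refl`;
  -- for the concrete element it cannot.
  glue : ∀ {a k} i (fi≡a : f i ≡ a) → index f a i fi≡a ≡ k → (f i , index f (f i) i ≡.refl) ≡ (a , k)
  glue i ≡.refl ≡.refl = ≡.refl

module _ {n r : ℕ} {size : Fin r → ℕ} (φ : Fin n ↔ (Σ[ a ∈ Fin r ] Fin (size a))) where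

  open Inverse φ using (to; from; strictlyInverseˡ; strictlyInverseʳ)

  private
    f : Fin n → Fin r
    f = proj₁ ∘ to

    second : ∀ {a} (x : Σ[ a ∈ Fin r ] Fin (size a)) → proj₁ x ≡ a → Fin (size a)
    second (a , k) ≡.refl = k

    second-injective : ∀ {a} x y (x₁≡a : proj₁ x ≡ a) (y₁≡a : proj₁ y ≡ a) → second x x₁≡a ≡ second y y₁≡a → x ≡ y
    second-injective (a , k) (a , k) ≡.refl ≡.refl ≡.refl = ≡.refl

    element-injective : ∀ {a k l} → element f a k ≡ element f a l → k ≡ l
    element-injective {a} {k} {l} eq =
      ≡.trans (≡.sym (index-element f a k (element-colour f a k)))
        (≡.trans (transport eq (element-colour f a k) (element-colour f a l))
          (index-element f a l (element-colour f a l)))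
      where
      transport : ∀ {i j} → i ≡ j → (fi≡a : f i ≡ a) (fj≡a : f j ≡ a) → index f a i fi≡a ≡ index f a j fj≡a
      transport ≡.refl ≡.refl ≡.refl = ≡.refl

  colour-from : ∀ a k → f (from (a , k)) ≡ a
  colour-from a k = ≡.cong proj₁ (strictlyInverseˡ (a , k))

  -- The bijection induces injections between the enumerated class and the fibre in both directions,
  -- one for each inequality.
  count-fibres : ∀ a → count f a ≡ size a
  count-fibres a = ℕ.≤-antisym
    (injective⇒≤ {f = λ k → second (to (element f a k)) (element-colour f a k)} λ eq →
      element-injective (to-injective (second-injective _ _ (element-colour f a _) (element-colour f a _) eq)))
    (injective⇒≤ {f = λ k → index f a (from (a , k)) (colour-from a k)} λ {k} {l} eq →
      pair-injective (from-injective (≡.trans (≡.sym (element-index f a _ (colour-from a k)))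
        (≡.trans (≡.cong (element f a) eq) (element-index f a _ (colour-from a l))))))
    where
    to-injective : ∀ {i j} → to i ≡ to j → i ≡ j
    to-injective {i} {j} eq = ≡.trans (≡.sym (strictlyInverseʳ i)) (≡.trans (≡.cong from eq) (strictlyInverseʳ j))
    from-injective : ∀ {x y} → from x ≡ from y → x ≡ y
    from-injective {x} {y} eq = ≡.trans (≡.sym (strictlyInverseˡ x)) (≡.trans (≡.cong to eq) (strictlyInverseˡ y))
    pair-injective : ∀ {k l : Fin (size a)} → (Σ[ a ∈ Fin r ] Fin (size a) ∋ (a , k)) ≡ (a , l) → k ≡ l
    pair-injective ≡.refl = ≡.refl

-- The extremal unweighted graphs

module Extremal {c ℓ₁ ℓ₂} (ℝ : RealField c ℓ₁ ℓ₂) where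

  open OrderedField ℝ
  open Kemeny ℝ
  open Walk ℝ
  open ColouredWalks ℝ
  open SetoidReasoning setoid

  minimal⇒onto : ∀ {n r} (G : WeightedGraph n) ((f , _) : Colorable (WeightedGraph.underlying G) r) →
                 (∀ s → Colorable (WeightedGraph.underlying G) s → r ℕ.≤ s) → ∀ a → ∃[ i ] f i ≡ a
  minimal⇒onto {r = suc r} G (f , proper) minimal a with any? (λ i → f i ≟ a)
  ... | yes fi≡a = fi≡a
  ... | no ∄i = ⊥-elim (ℕ.1+n≰n (minimal r
          ( (λ i → punchOut (a≢f i))
          , λ i~j eq → proper i~j (punchOut-injective (a≢f _) (a≢f _) eq))))
    where
    a≢f : ∀ i → a ≢ f i
    a≢f i a≡fi = ∄i (i , ≡.sym a≡fi)

  fromℕ-count : ∀ {n r} (f : Fin n → Fin r) a → fromℕ (count f a) ≈ sum (λ j → δ a (f j))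
  fromℕ-count {zero}  f a = refl
  fromℕ-count {suc n} f a with a ≟ f zero
  ... | yes _ = +-congˡ (fromℕ-count (f ∘ suc) a)
  ... | no  _ = trans (fromℕ-count (f ∘ suc) a) (sym (+-identityˡ _))

  sum-δ-1 : ∀ {n} (i : Fin n) → sum (λ a → δ a i) ≈ 1#
  sum-δ-1 i = trans (sum-cong-≋ (λ a → trans (δ-sym a i) (sym (*-identityʳ _)))) (sum-δ i (λ _ → 1#))

  sum-fromℕ-count : ∀ {n r} (f : Fin n → Fin r) → sum (λ a → fromℕ (count f a)) ≈ fromℕ n
  sum-fromℕ-count {n} f = begin
    sum (λ a → fromℕ (count f a))              ≈⟨ sum-cong-≋ (fromℕ-count f) ⟩
    sum (λ a → sum (λ j → δ a (f j)))          ≈⟨ ∑-comm (λ a j → δ a (f j)) ⟩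
    sum (λ j → sum (λ a → δ a (f j)))          ≈⟨ sum-cong-≋ (λ j → sum-δ-1 (f j)) ⟩
    sum {n} (λ _ → 1#)                         ≈⟨ sum-replicate n ⟩
    fromℕ n                                    ∎

  fromℕ-* : ∀ m n → fromℕ (m ℕ.* n) ≈ fromℕ m * fromℕ n
  fromℕ-* = ×1-homo-*

  fromℕ-+ : ∀ m n → fromℕ (m ℕ.+ n) ≈ fromℕ m + fromℕ n
  fromℕ-+ = ×-homo-+ 1#

  -- Double counting is done with the real sums already at hand and pulled back by injectivity of
  -- `fromℕ`.
  constant-count : ∀ {n r} (f : Fin n → Fin r) {q} → (∀ a → count f a ≡ q) → n ≡ q ℕ.* r
  constant-count {n} {r} f {q} count≡q = fromℕ-injective (begin
    fromℕ n                                ≈⟨ sum-fromℕ-count f ⟨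
    sum (λ a → fromℕ (count f a))          ≈⟨ sum-cong-≋ (λ a → trans (reflexive (≡.cong fromℕ (count≡q a))) (sym (*-identityʳ _))) ⟩
    sum {r} (λ _ → fromℕ q * 1#)           ≈⟨ *-distribˡ-sum {r} (fromℕ q) (λ _ → 1#) ⟨
    fromℕ q * sum {r} (λ _ → 1#)           ≈⟨ *-congˡ (sum-replicate r) ⟩
    fromℕ q * fromℕ r                      ≈⟨ fromℕ-* q r ⟨
    fromℕ (q ℕ.* r)                        ∎)

  count₀+count₁ : ∀ {n} (f : Fin n → Fin 2) → count f zero ℕ.+ count f (suc zero) ≡ n
  count₀+count₁ {n} f = fromℕ-injective (begin
    fromℕ (count f zero ℕ.+ count f (suc zero))                ≈⟨ fromℕ-+ (count f zero) _ ⟩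
    fromℕ (count f zero) + fromℕ (count f (suc zero))          ≈⟨ +-congˡ (+-identityʳ _) ⟨
    sum (λ a → fromℕ (count f a))                              ≈⟨ sum-fromℕ-count f ⟩
    fromℕ n                                                    ∎)

  module UnweightedMultipartite {n : ℕ} (2≤n : 2 ℕ.≤ n) (G : WeightedGraph n)
    (unweighted : WeightedGraph.Unweighted G)
    {r : ℕ} (f : Fin n → Fin r)
    (proper   : ∀ {i j} → WeightedGraph._~_ G i j → f i ≢ f j)
    (complete : ∀ {i j} → f i ≢ f j → WeightedGraph._~_ G i j)
    (onto     : ∀ a → ∃[ i ] f i ≡ a)
    (ρ        : Carrier)
    (ρr≈1     : ρ * fromℕ r ≈ 1#)
    where

    open KemenyWalk 2≤n G
    open ColouredWalk 2≤n G f proper onto ρ ρr≈1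

    -- The size of a class and the common degree of its vertices, which are joined to everything
    -- outside the class.
    N M : Fin r → ℕ
    N a = count f a
    M a = n ℕ.∸ N a

    N+M≡n : ∀ a → N a ℕ.+ M a ≡ n
    N+M≡n a = ℕ.m+[n∸m]≡n (count≤n f a)

    p≈scale : ∀ {j k} → f j ≢ f k → p j k ≈ scale
    p≈scale fj≢fk = trans (*-congˡ (unweighted (complete fj≢fk))) (*-identityʳ scale)

    p≈ : ∀ i j → p i j ≈ scale * (1# - χ i j)
    p≈ i j = case f i ≟ f j of λ where
      (yes fi≡fj) → trans (same-class⇒p≈0 fi≡fj) (sym (trans (*-congˡ (trans (+-congˡ (-‿cong (δ-≡ fi≡fj))) (-‿inverseʳ 1#))) (zeroʳ scale)))
      (no fi≢fj)  → *-congˡ (trans (unweighted (complete fi≢fj)) (sym (trans (+-congˡ (-‿cong (δ-≢ fi≢fj))) (x-0≈x 1#))))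

    stat≈M : ∀ i → stat i ≈ scale * fromℕ (M (f i))
    stat≈M i = begin
      sum (p i)                                                   ≈⟨ sum-cong-≋ (p≈ i) ⟩
      sum (λ j → scale * (1# - χ i j))                            ≈⟨ *-distribˡ-sum scale (λ j → 1# - χ i j) ⟨
      scale * sum (λ j → 1# - χ i j)                              ≈⟨ *-congˡ (∑-distrib-‿- (λ _ → 1#) (χ i)) ⟩
      scale * (sum {n} (λ _ → 1#) - sum (χ i))                    ≈⟨ *-congˡ (+-cong (sum-replicate n) (-‿cong (sym (fromℕ-count f (f i))))) ⟩
      scale * (fromℕ n - fromℕ (N (f i)))                         ≡⟨ ≡.cong (λ k → scale * (fromℕ k - fromℕ (N (f i)))) (N+M≡n (f i)) ⟨
      scale * (fromℕ (N (f i) ℕ.+ M (f i)) - fromℕ (N (f i)))     ≈⟨ *-congˡ (+-congʳ (fromℕ-+ (N (f i)) (M (f i)))) ⟩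
      scale * (fromℕ (N (f i)) + fromℕ (M (f i)) - fromℕ (N (f i))) ≈⟨ *-congˡ (solve 2 (λ x y → x :+ y :- x := y) refl _ _) ⟩
      scale * fromℕ (M (f i))                                     ∎

    mass≈NM : ∀ a → mass a ≈ scale * fromℕ (N a ℕ.* M a)
    mass≈NM a = begin
      sum (λ j → δ a (f j) * stat j)                       ≈⟨ sum-cong-≋ same ⟩
      sum (λ j → δ a (f j) * (scale * fromℕ (M a)))        ≈⟨ *-distribʳ-sum (scale * fromℕ (M a)) (λ j → δ a (f j)) ⟨
      sum (λ j → δ a (f j)) * (scale * fromℕ (M a))        ≈⟨ *-congʳ (fromℕ-count f a) ⟨
      fromℕ (N a) * (scale * fromℕ (M a))                  ≈⟨ solve 3 (λ x y z → x :* (y :* z) := y :* (x :* z)) refl _ _ _ ⟩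
      scale * (fromℕ (N a) * fromℕ (M a))                  ≈⟨ *-congˡ (fromℕ-* (N a) (M a)) ⟨
      scale * fromℕ (N a ℕ.* M a)                          ∎
      where
      same : ∀ j → δ a (f j) * stat j ≈ δ a (f j) * (scale * fromℕ (M a))
      same j = case a ≟ f j of λ where
        (yes ≡.refl) → *-congˡ (stat≈M j)
        (no a≢fj)    → trans (*-congʳ (δ-≢ a≢fj)) (trans (zeroˡ _) (sym (trans (*-congʳ (δ-≢ a≢fj)) (zeroˡ _))))

    toClass≈N : ∀ {i j} → f i ≢ f j → toClass i j ≈ scale * fromℕ (N (f i))
    toClass≈N {i} {j} fi≢fj = begin
      sum (λ k → p j k * χ i k)         ≈⟨ sum-cong-≋ same ⟩
      sum (λ k → scale * χ i k)         ≈⟨ *-distribˡ-sum scale (χ i) ⟨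
      scale * sum (χ i)                 ≈⟨ *-congˡ (fromℕ-count f (f i)) ⟨
      scale * fromℕ (N (f i))           ∎
      where
      same : ∀ k → p j k * χ i k ≈ scale * χ i k
      same k = case f i ≟ f k of λ where
        (yes fi≡fk) → *-congʳ (p≈scale (λ fj≡fk → fi≢fj (≡.trans fi≡fk (≡.sym fj≡fk))))
        (no fi≢fk)  → trans (*-congˡ (δ-≢ fi≢fk)) (trans (zeroʳ _) (sym (trans (*-congˡ (δ-≢ fi≢fk)) (zeroʳ _))))

    flow≈ : ∀ {i j} → f i ≢ f j → stat i * (stat j + toClass i j) ≈
            scale * (scale * fromℕ (M (f i) ℕ.* (M (f j) ℕ.+ N (f i))))
    flow≈ {i} {j} fi≢fj = begin
      stat i * (stat j + toClass i j)
        ≈⟨ *-cong (stat≈M i) (+-cong (stat≈M j) (toClass≈N fi≢fj)) ⟩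
      scale * fromℕ (M (f i)) * (scale * fromℕ (M (f j)) + scale * fromℕ (N (f i)))
        ≈⟨ solve 4 (λ s x y z → s :* x :* (s :* y :+ s :* z) := s :* (s :* (x :* (y :+ z)))) refl scale _ _ _ ⟩
      scale * (scale * (fromℕ (M (f i)) * (fromℕ (M (f j)) + fromℕ (N (f i)))))
        ≈⟨ *-congˡ (*-congˡ (trans (fromℕ-* (M (f i)) _) (*-congˡ (fromℕ-+ (M (f j)) (N (f i)))))) ⟨
      scale * (scale * fromℕ (M (f i) ℕ.* (M (f j) ℕ.+ N (f i))))
        ∎

    module _ {K : Carrier} (isK : IsKemenyConstant 2≤n G K) where

      open Bound isK

      -- By `tight⇒flow`, `M a * (M b + N a)` has the same value for every `b` other than `a`, so
      -- `M b` does not depend on `b`. Comparing two distinct classes takes a third one, which is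
      -- why two classes may differ in size.
      tight⇒count≡ : K ≈ bound → ∀ {a b b′} → a ≢ b → a ≢ b′ → N b ≡ N b′
      tight⇒count≡ K≈bound {a} {b} {b′} a≢b a≢b′ with onto a | onto b | onto b′
      ... | i , ≡.refl | j , ≡.refl | j′ , ≡.refl = ℕ.+-cancelʳ-≡ (M b) (N b) (N b′) (≡.trans (N+M≡n b)
              (≡.trans (≡.sym (N+M≡n b′)) (≡.cong (N b′ ℕ.+_) (≡.sym M≡M′))))
        where
        one : ∀ {k} → a ≢ f k → scale * fromℕ (M a ℕ.* (M (f k) ℕ.+ N a)) ≈ 1#
        one {k} a≢fk = *-cancelˡ-pos scale>0 (begin
          scale * (scale * fromℕ (M a ℕ.* (M (f k) ℕ.+ N a)))   ≈⟨ flow≈ {i} {k} a≢fk ⟨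
          stat i * (stat k + toClass i k)                       ≈⟨ tight⇒flow K≈bound a≢fk ⟩
          p k i                                                 ≈⟨ p≈scale (a≢fk ∘ ≡.sym) ⟩
          scale                                                 ≈⟨ *-identityʳ scale ⟨
          scale * 1#                                            ∎)
        Ma≢0 : M a ≢ 0
        Ma≢0 Ma≡0 = 0≮0 (trans (stat≈M i) (trans (*-congˡ (reflexive (≡.cong fromℕ Ma≡0))) (zeroʳ scale))) (stat>0 i)
        M≡M′ : M b ≡ M b′
        M≡M′ = ℕ.+-cancelʳ-≡ (N a) (M b) (M b′) (ℕ.*-cancelˡ-≡ _ _ (M a) {{ℕ.≢-nonZero Ma≢0}}
          (fromℕ-injective (*-cancelˡ-pos scale>0 (trans (one a≢b) (sym (one a≢b′))))))

      -- Here `κ` is the number of edges leaving a class. All classes together give the degree sum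
      -- `r * κ`, the reciprocal of `scale`, and this reduces both conditions of `mass∧flow⇒tight`
      -- to arithmetic.
      counts⇒tight : ∀ κ → (∀ a → N a ℕ.* M a ≡ κ) → (∀ {a b} → a ≢ b → M a ℕ.* (M b ℕ.+ N a) ≡ r ℕ.* κ) → K ≈ bound
      counts⇒tight κ NM≡κ balanced = mass∧flow⇒tight mass≈ρ λ {i} {j} fi≢fj → begin
        stat i * (stat j + toClass i j)                                 ≈⟨ flow≈ fi≢fj ⟩
        scale * (scale * fromℕ (M (f i) ℕ.* (M (f j) ℕ.+ N (f i))))     ≡⟨ ≡.cong (λ k → scale * (scale * fromℕ k)) (balanced fi≢fj) ⟩
        scale * (scale * fromℕ (r ℕ.* κ))                               ≈⟨ *-congˡ total≈1 ⟩
        scale * 1#                                                      ≈⟨ *-identityʳ scale ⟩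
        scale                                                           ≈⟨ p≈scale (fi≢fj ∘ ≡.sym) ⟨
        p j i                                                           ∎
        where
        mass≈ : ∀ a → mass a ≈ scale * fromℕ κ
        mass≈ a = trans (mass≈NM a) (*-congˡ (reflexive (≡.cong fromℕ (NM≡κ a))))
        mass-total : sum mass ≈ 1#
        mass-total = begin
          sum (λ a → sum (λ j → δ a (f j) * stat j))     ≈⟨ ∑-comm (λ a j → δ a (f j) * stat j) ⟩
          sum (λ j → sum (λ a → δ a (f j) * stat j))     ≈⟨ sum-cong-≋ (λ j → trans (sym (*-distribʳ-sum (stat j) (λ a → δ a (f j)))) (trans (*-congʳ (sum-δ-1 (f j))) (*-identityˡ _))) ⟩
          sum stat                                       ≈⟨ stat-total ⟩
          1#                                             ∎
        total≈1 : scale * fromℕ (r ℕ.* κ) ≈ 1#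
        total≈1 = begin
          scale * fromℕ (r ℕ.* κ)                    ≈⟨ *-congˡ (fromℕ-* r κ) ⟩
          scale * (fromℕ r * fromℕ κ)                ≈⟨ solve 3 (λ s r k → s :* (r :* k) := s :* k :* r) refl scale _ _ ⟩
          scale * fromℕ κ * fromℕ r                  ≈⟨ *-congˡ (sum-replicate r) ⟨
          scale * fromℕ κ * sum {r} (λ _ → 1#)       ≈⟨ *-distribˡ-sum {r} (scale * fromℕ κ) (λ _ → 1#) ⟩
          sum {r} (λ _ → scale * fromℕ κ * 1#)       ≈⟨ sum-cong-≋ (λ a → trans (*-identityʳ _) (sym (mass≈ a))) ⟩
          sum mass                                   ≈⟨ mass-total ⟩
          1#                                         ∎
        mass≈ρ : ∀ a → mass a ≈ ρ
        mass≈ρ a = begin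
          mass a                                 ≈⟨ mass≈ a ⟩
          scale * fromℕ κ                        ≈⟨ *-identityʳ _ ⟨
          scale * fromℕ κ * 1#                   ≈⟨ *-congˡ ρr≈1 ⟨
          scale * fromℕ κ * (ρ * fromℕ r)        ≈⟨ solve 4 (λ s k ρ r → s :* k :* (ρ :* r) := ρ :* (s :* (r :* k))) refl scale _ ρ _ ⟩
          ρ * (scale * (fromℕ r * fromℕ κ))      ≈⟨ *-congˡ (trans (*-congˡ (sym (fromℕ-* r κ))) total≈1) ⟩
          ρ * 1#                                 ≈⟨ *-identityʳ ρ ⟩
          ρ                                      ∎

  fibres-≅ : ∀ {n r} (G : WeightedGraph n) (f : Fin n → Fin r) →
             (∀ {i j} → WeightedGraph._~_ G i j → f i ≢ f j) → (∀ {i j} → f i ≢ f j → WeightedGraph._~_ G i j) →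
             ∀ {size} → (∀ a → count f a ≡ size a) → WeightedGraph.underlying G ≅ completeMultipartite size
  fibres-≅ G f proper complete {size} count≡size = record
    { bijection = Σ-↔ ↔-refl (λ {a} → cast-id (count≡size a)) ↔-∘ Fin↔fibres f
    ; adjacency = λ i j → mk⇔ proper complete
    }

  nonZero-count : ∀ {n r} (f : Fin n → Fin r) → (∀ a → ∃[ i ] f i ≡ a) → ∀ a → NonZero (count f a)
  nonZero-count f onto a with onto a
  ... | i , fi≡a = nonZeroIndex (index f a i fi≡a)

  third : ∀ {r} (b b′ : Fin (3 ℕ.+ r)) → ∃[ a ] a ≢ b × a ≢ b′
  third zero          zero           = suc zero , (λ ()) , (λ ())
  third zero          (suc zero)     = suc (suc zero) , (λ ()) , (λ ())
  third zero          (suc (suc _))  = suc zero , (λ ()) , (λ ())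
  third (suc zero)    zero           = suc (suc zero) , (λ ()) , (λ ())
  third (suc (suc _)) zero           = suc zero , (λ ()) , (λ ())
  third (suc _)       (suc _)        = zero , (λ ()) , (λ ())

  module _ {n : ℕ} (2≤n : 2 ℕ.≤ n) (G : WeightedGraph n) (unweighted : WeightedGraph.Unweighted G)
    {r : ℕ} (ρ : Carrier) (ρr≈1 : ρ * fromℕ r ≈ 1#) {K : Carrier} (isK : IsKemenyConstant 2≤n G K) where

    open WeightedGraph G using (_~_; underlying)

    Shape : Set
    Shape = (r ≡ 2 × IsCompleteBipartite underlying) ⊎ (3 ℕ.≤ r × (Σ[ r∣n ∈ r ∣ n ] underlying ≅ Turán r∣n))

    tight⇒shape : (f : Fin n → Fin r) (proper : ∀ {i j} → i ~ j → f i ≢ f j) → (∀ a → ∃[ i ] f i ≡ a) →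
                  K ≈ fromℕ n - fromℕ 2 + ρ → Shape
    tight⇒shape f proper onto K≈bound = shape r ≡.refl
      where
      open KemenyWalk 2≤n G using (stat; stat>0)
      open ColouredWalk 2≤n G f proper onto ρ ρr≈1 using (same-class⇒p≈0; module Bound)
      open Bound isK using (tight⇒edge)
      open UnweightedMultipartite 2≤n G unweighted f proper (tight⇒edge K≈bound) onto ρ ρr≈1
      v : Fin n
      v = fromℕ< (ℕ.≤-trans (ℕ.s≤s ℕ.z≤n) 2≤n)
      shape : ∀ k → r ≡ k → Shape
      shape 0 ≡.refl = case f v of λ ()
      -- With a single colour there are no edges, so a vertex would have stationary weight 0.
      shape 1 ≡.refl = ⊥-elim (0≮0 (trans (sum-cong-≋ (λ j → same-class⇒p≈0 (only (f v) (f j)))) (sum-replicate-zero n)) (stat>0 v))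
        where
        only : (a b : Fin 1) → a ≡ b
        only zero zero = ≡.refl
      shape 2 ≡.refl = inj₁ (≡.refl , count f , nonZero-count f onto , fibres-≅ G f proper (tight⇒edge K≈bound) (λ _ → ≡.refl))
      shape (suc (suc (suc k))) ≡.refl = inj₂ (ℕ.s≤s (ℕ.s≤s (ℕ.s≤s ℕ.z≤n)) ,
          divides (count f zero) (constant-count f equal) , fibres-≅ G f proper (tight⇒edge K≈bound) equal)
        where
        equal : ∀ a → count f a ≡ count f zero
        equal a = let (b , b≢a , b≢0) = third a zero in tight⇒count≡ isK K≈bound b≢a b≢0

    -- The test vectors are built from the parts that the isomorphism supplies, not from the given
    -- minimal colouring: `bound` depends on the colouring only through ρ, so the two need not be
    -- compared.
    multipartite⇒tight : ∀ {size : Fin r → ℕ} → (∀ a → NonZero (size a)) → underlying ≅ completeMultipartite size → ∀ κ →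
      (∀ a → size a ℕ.* (n ℕ.∸ size a) ≡ κ) → (∀ {a b} → a ≢ b → (n ℕ.∸ size a) ℕ.* (n ℕ.∸ size b ℕ.+ size a) ≡ r ℕ.* κ) →
      K ≈ fromℕ n - fromℕ 2 + ρ
    multipartite⇒tight {size} nonZero G≅ κ NM≡κ balanced =
      counts⇒tight isK κ
        (λ a → ≡.trans (≡.cong (λ N → N ℕ.* (n ℕ.∸ N)) (count-fibres bijection a)) (NM≡κ a))
        (λ {a} {b} a≢b → ≡.trans
          (≡.cong₂ (λ N N′ → (n ℕ.∸ N) ℕ.* (n ℕ.∸ N′ ℕ.+ N)) (count-fibres bijection a) (count-fibres bijection b))
          (balanced a≢b))
      where
      open _≅_ G≅
      onto : ∀ a → ∃[ i ] proj₁ (Inverse.to bijection i) ≡ a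
      onto a = Inverse.from bijection (a , first) , colour-from bijection a first
        where
        first : Fin (size a)
        first = fromℕ< (ℕ.>-nonZero⁻¹ (size a) {{nonZero a}})
      open UnweightedMultipartite 2≤n G unweighted (proj₁ ∘ Inverse.to bijection)
        (λ {i} {j} → Equivalence.to (adjacency i j)) (λ {i} {j} → Equivalence.from (adjacency i j)) onto ρ ρr≈1

    shape⇒tight : Shape → K ≈ fromℕ n - fromℕ 2 + ρ
    shape⇒tight (inj₁ (≡.refl , size , nonZero , G≅)) =
      -- Each part is the complement of the other, so the product of size and degree is the same for
      -- both, and `M b + N a` is twice `size a`.
      multipartite⇒tight nonZero G≅ (size zero ℕ.* size (suc zero)) NM balanced
      where
      open _≅_ G≅ using (bijection)
      size₀+size₁ : size zero ℕ.+ size (suc zero) ≡ n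
      size₀+size₁ = ≡.trans (≡.sym (≡.cong₂ ℕ._+_ (count-fibres bijection zero) (count-fibres bijection (suc zero)))) (count₀+count₁ _)
      M₀ : n ℕ.∸ size zero ≡ size (suc zero)
      M₀ = ≡.trans (≡.cong (ℕ._∸ size zero) (≡.sym size₀+size₁)) (ℕ.m+n∸m≡n (size zero) _)
      M₁ : n ℕ.∸ size (suc zero) ≡ size zero
      M₁ = ≡.trans (≡.cong (ℕ._∸ size (suc zero)) (≡.sym size₀+size₁)) (ℕ.m+n∸n≡m (size zero) (size (suc zero)))
      NM : ∀ a → size a ℕ.* (n ℕ.∸ size a) ≡ size zero ℕ.* size (suc zero)
      NM zero       = ≡.cong (size zero ℕ.*_) M₀
      NM (suc zero) = ≡.trans (≡.cong (size (suc zero) ℕ.*_) M₁) (ℕ.*-comm (size (suc zero)) _)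
      double₀ : ∀ x y → y ℕ.* (x ℕ.+ x) ≡ 2 ℕ.* (x ℕ.* y)
      double₀ = solve-∀
      double₁ : ∀ x y → x ℕ.* (y ℕ.+ y) ≡ 2 ℕ.* (x ℕ.* y)
      double₁ = solve-∀
      balanced : ∀ {a b} → a ≢ b → (n ℕ.∸ size a) ℕ.* (n ℕ.∸ size b ℕ.+ size a) ≡ 2 ℕ.* (size zero ℕ.* size (suc zero))
      balanced {zero}     {zero}     a≢b = ⊥-elim (a≢b ≡.refl)
      balanced {zero}     {suc zero} a≢b = ≡.trans (≡.cong₂ (λ x y → x ℕ.* (y ℕ.+ size zero)) M₀ M₁) (double₀ (size zero) (size (suc zero)))
      balanced {suc zero} {zero}     a≢b = ≡.trans (≡.cong₂ (λ x y → x ℕ.* (y ℕ.+ size (suc zero))) M₁ M₀) (double₁ (size zero) (size (suc zero)))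
      balanced {suc zero} {suc zero} a≢b = ⊥-elim (a≢b ≡.refl)
    shape⇒tight (inj₂ (3≤r , divides q n≡q*r , G≅)) =
      -- All parts have size `q` and degree `M`; the balance condition holds because `M + q` is `n`,
      -- that is `q * r`.
      multipartite⇒tight (λ _ → ℕ.≢-nonZero q≢0) G≅ (q ℕ.* M) (λ _ → ≡.refl) λ _ → balanced
      where
      M : ℕ
      M = n ℕ.∸ q
      q≢0 : q ≢ 0
      q≢0 ≡.refl = case ≡.subst (2 ℕ.≤_) n≡q*r 2≤n of λ ()
      q≤n : q ℕ.≤ n
      q≤n = ≡.subst (q ℕ.≤_) (≡.sym n≡q*r) (ℕ.m≤m*n q r {{ℕ.>-nonZero (ℕ.≤-trans (ℕ.s≤s ℕ.z≤n) 3≤r)}})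
      rearrange : ∀ M q r → M ℕ.* (q ℕ.* r) ≡ r ℕ.* (q ℕ.* M)
      rearrange = solve-∀
      balanced : M ℕ.* (M ℕ.+ q) ≡ r ℕ.* (q ℕ.* M)
      balanced = ≡.trans (≡.cong (M ℕ.*_) (≡.trans (ℕ.m∸n+n≡m q≤n) n≡q*r)) (rearrange M q r)

corollary4p2 : ∀ {c ℓ₁ ℓ₂} (ℝ : RealField c ℓ₁ ℓ₂) →
    let open RealField ℝ
        open Kemeny ℝ in
    ∀ (n : ℕ) (2≤n : 2 ℕ.≤ n) (G : WeightedGraph n) →
    let open WeightedGraph G in
    ∀ (r : ℕ) (χ≡r : IsChromaticNumber underlying r)
      (K : Carrier) → IsKemenyConstant 2≤n G K →
    let bound = fromℕ n - fromℕ 2 + 1/ r {{chromatic-nonZero 2≤n G χ≡r}} in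
    (bound ≤ K) ×
    (Unweighted →
      K ≈ bound ⇔
        ((r ≡ 2 × IsCompleteBipartite underlying) ⊎
         (3 ℕ.≤ r × (Σ[ r∣n ∈ r ∣ n ] underlying ≅ Turán r∣n))))
corollary4p2 ℝ n 2≤n G r χ≡r@((f , proper) , minimal) K isK =
  Bound.bound≤K isK ,
  λ unweighted → mk⇔ (tight⇒shape 2≤n G unweighted ρ ρr≈1 isK f proper onto) (shape⇒tight 2≤n G unweighted ρ ρr≈1 isK)
  where
  open Extremal ℝ
  open OrderedField ℝ
  instance
    r-nonZero : NonZero r
    r-nonZero = Kemeny.chromatic-nonZero ℝ 2≤n G χ≡r
  ρ : Carrier
  ρ = 1/ r
  ρr≈1 : ρ * fromℕ r ≈ 1#
  ρr≈1 = *-inverseˡ (fromℕ-pos r)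
  onto : ∀ a → ∃[ i ] f i ≡ a
  onto = minimal⇒onto G (f , proper) minimal
  open ColouredWalks.ColouredWalk ℝ 2≤n G f proper onto ρ ρr≈1
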